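{- Let $P=(S_1|\dots|S_k)$ be a partition of a finite set $I$ and let $\mathcal F=(\mathcal T_1|\dots|\mathcal T_k):P\leftarrow Q$ be a layered forest. For $1\le j\le k$ let ${}^IQ_j$ denote the partition of $I$ consisting of the blocks of $Q$ contained in $S_j$ together with the singletons $\{i\}$, $i\in I- S_j$. Then $$\boldsymbol\partial_{\mathcal F}\circ \mathbf{prod}_P=\mathbf{prod}_P\circ(\otimes\boldsymbol\partial_{\mathcal F})$$ as linear maps $\bigotimes_j\mathsf L^{\vee*}[{}^IS_j]\to\mathsf L^{\vee*}[Q]$. Here on the left $\mathbf{prod}_P:\bigotimes_j\mathsf L^{\vee*}[{}^IS_j]\to\mathsf L^{\vee*}[P]$, on the right $\mathbf{prod}_P:\bigotimes_j\mathsf L^{\vee*}[{}^IQ_j]\to\mathsf L^{\vee*}[Q]$, and $\otimes\boldsymbol\partial_{\mathcal F}:\bigotimes_j\mathsf L^{\vee*}[{}^IS_j]\to\bigotimes_j\mathsf L^{\vee*}[{}^IQ_j]$ is the tensor product $f_1\otimes\dots\otimes f_k\mapsto\boldsymbol\partial_1f_1\otimes\dots\otimes\boldsymbol\partial_kf_k$, where $\boldsymbol\partial_j:\mathsf L^{\vee*}[{}^IS_j]\to\mathsf L^{\vee*}[{}^IQ_j]$ is the forest derivative with respect to the layered forest ${}^IS_j\leftarrow{}^IQ_j$ obtained by completing $\mathcal T_j$ (with the layering restricted from $\mathcal F$) with sticks labelled by the singletons $\{i\}$, $i\in I- S_j$.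
   Context: **Arrangement and faces.** $\Bbbk$ is a field of characteristic zero. A partition $P=(S_1|\dots|S_k)$ of $I$ is an unordered set of disjoint nonempty blocks with union $I$; $Q$ is finer than $P$ if every block of $Q$ is contained in a block of $P$ ($Q=P$ allowed). $(I)$ is the one-block partition; for $S\subseteq I$, ${}^IS$ is the partition of $I$ with block $S$ and all other blocks singletons. Put $T^\vee[P]=\{h\in\mathbb R I:\sum_{i\in S_j}h_i=0 \text{ for all } j\}$ and $T^\vee[I]=T^\vee[(I)]$. The adjoint braid arrangement consists of the hyperplanes $\{\sum_{i\in S}h_i=0\}$ of $T^\vee[I]$, for $\emptyset\ne S\subsetneq I$. An adjoint face $X$ is (the characteristic function of) a relatively open face of this arrangement; it is determined by its sign function $s_X$, where $s_X(S)\in\{+,-,0\}$ is the sign of $\sum_{i\in S}h_i$ for $h$ in the face, $\emptyset\neq S\subsetneq I$. Its support is the linear span of the face. $\mathsf L^\vee[P]$ is the $\Bbbk$-vector space with basis the adjoint faces with support $T^\vee[P]$; $\mathsf L^{\vee *}[P]$ is its dual, whose elements are called functionals. **External product.** Let $P=(S_1|\dots|S_k)$ and let $Q$ be finer than $P$. For an adjoint face $X\in\mathsf L^\vee[Q]$, $X|_{S_j}\in\mathsf L^\vee[{}^IQ_j]$ is the adjoint face with sign $S\mapsto s_X(S\cap S_j)$ if $S\cap S_j\ne\emptyset$, and $0$ if $S\cap S_j=\emptyset$. Then $\mathbf{prod}_P:\bigotimes_j\mathsf L^{\vee*}[{}^IQ_j]\to\mathsf L^{\vee*}[Q]$ is given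 by $\mathbf{prod}_P(f_1\otimes\dots\otimes f_k)(X)=\prod_jf_j(X|_{S_j})$. (For $Q=P$ one has ${}^IQ_j={}^IS_j$.) **Forests and forest derivative.** A tree over a finite set $S$ is a planar full binary tree whose leaves are labelled bijectively by the blocks of a partition of $S$; a one-leaf tree is a stick. A layered forest $\mathcal F=(\mathcal T_1|\dots|\mathcal T_k):P\leftarrow Q$ is a family of trees, $\mathcal T_j$ over $S_j$, whose leaves are labelled bijectively by the blocks of $Q$, together with a linear order (layering) on all the (internal) nodes in which each node precedes its descendants. For $E\subseteq I$, $\mathrm{Redn}_P(E)$ is $E$ with all blocks of $P$ contained in $E$ removed; write $E=S \bmod P$ if $\mathrm{Redn}_P(E)=\mathrm{Redn}_P(S)$. A cut $\mathcal V=[C,D]:P\leftarrow Q$ is a forest with exactly one node: an ordered splitting of one block $S_m=C\sqcup D$ of $P$ ($C,D\neq\emptyset$; $C$ on the left, $D$ on the right), where $Q$ is $P$ with $S_m$ replaced by $C$ and $D$; $\overline{\mathcal V}=[D,C]$. For an adjoint face $X\in\mathsf L^\vee[Q]$, $X^{\mathcal V}\in\mathsf L^\vee[P]$ is the adjoint face with sign at $S$ equal to $+$ if $S=C\bmod P$, $-$ if $S=D\bmod P$, $s_X(S)$ if $S\ne\emptyset\bmod Q$, and $0$ if $S=\emptyset\bmod P$. For $f\in\mathsf L^{\vee*}[P]$ set $\boldsymbol\partial_{\mathcal V}f(X)=f(X^{\mathcal V})-f(X^{\overline{\mathcal V}})$. Every layered forest decomposes uniquely as a sequence of successive cuts $\mathcal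 F=\mathcal V_1\circ\dots\circ\mathcal V_l$ in the order of its nodes (starting from $P$, ending at $Q$). Set $\boldsymbol\partial_{\mathcal F}f=\boldsymbol\partial_{\mathcal V_l}(\cdots(\boldsymbol\partial_{\mathcal V_1}f)\cdots)$; if $l=0$ this is the identity. -}

module Defs where

open import Algebra.Bundles using (CommutativeRing; Semiring)
import Algebra.Definitions.RawSemiring as RawSemiringDefinitions
open import Algebra.Module.Bundles using (LeftModule)
import Algebra.Module.Construct.TensorUnit as TensorUnit
import Algebra.Module.Morphism.Construct.Composition as Composition
open import Algebra.Module.Morphism.Structures using (module LeftModuleMorphisms)
import Algebra.Properties.CommutativeMonoid.Sum as Sum
import Algebra.Properties.Group as GroupProperties
import Algebra.Properties.Ring as RingProperties
import Algebra.Properties.Semiring.Sum as SemiringSum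
open import Data.Bool.Base using (Bool; true; false; if_then_else_; not; _∧_; _∨_)
import Data.Bool.Properties as Bool
open import Data.Empty using (⊥-elim)
open import Data.Fin.Base using (Fin; zero; suc)
import Data.Fin.Properties as Fin
open import Data.Fin.Subset as Subset
  using (Subset; ⁅_⁆; _∈_; _∉_; _⊆_; _⊈_; _∩_; _∪_; _─_; ⋃; Nonempty; Empty)
import Data.Fin.Subset.Properties as Subset
open import Data.List.Base as List
  using (List; []; _∷_; [_]; _++_; map; filter; concat; tabulate; lookup; length; allFin; mapMaybe)
import Data.List.Membership.DecPropositional as DecMembership
open import Data.List.Membership.Propositional using (find; lose)
  renaming (_∈_ to _∈ˡ_; _∉_ to _∉ˡ_)
import Data.List.Membership.Propositional.Properties as ∈ˡ
import Data.List.Properties as List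
open import Data.List.Relation.Binary.Permutation.Propositional
  using (_↭_; ↭-refl; ↭-sym; ↭-trans; ↭-reflexive; prep; swap)
import Data.List.Relation.Binary.Permutation.Propositional.Properties as ↭
open import Data.List.Relation.Unary.All as All using (All; []; _∷_)
import Data.List.Relation.Unary.All.Properties as All
open import Data.List.Relation.Unary.AllPairs as AllPairs using (AllPairs; []; _∷_)
import Data.List.Relation.Unary.AllPairs.Properties as AllPairs
open import Data.List.Relation.Unary.Any as Any using (Any; here; there)
import Data.List.Relation.Unary.Any.Properties as Any
open import Data.List.Relation.Unary.Unique.Propositional using (Unique)
import Data.List.Relation.Unary.Unique.Propositional.Properties as Unique
open import Data.Maybe.Base using (Maybe; just; nothing)
open import Data.Nat.Base using (ℕ; zero; suc)
open import Data.Product.Base using (Σ; ∃; _×_; _,_; proj₁; proj₂)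
open import Data.Sum.Base using (_⊎_; inj₁; inj₂; [_,_]′)
open import Data.Vec.Base as Vec using ([]; _∷_; here; there)
import Data.Vec.Properties as Vec
open import Function.Base using (id; _∘_; case_of_)
open import Level using (Level; _⊔_; 0ℓ)
open import Relation.Binary.Bundles using (Setoid)
open import Relation.Binary.Core using (Rel)
open import Relation.Binary.Definitions using (DecidableEquality; tri<; tri≈; tri>)
open import Relation.Binary.PropositionalEquality as ≡ using (_≡_; _≢_; cong; cong₂; subst)
import Relation.Binary.Reasoning.Setoid as SetoidReasoning
open import Relation.Binary.Structures using (IsStrictTotalOrder)
open import Relation.Nullary using (¬_; Dec; yes; no; does; contradiction)
open import Relation.Nullary.Decidable using (¬?; dec-true; dec-false)
open import Relation.Unary using (Pred; _≐_)

record Field c ℓ : Set (Level.suc (c ⊔ ℓ)) where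
  field
    commutativeRing : CommutativeRing c ℓ
  open CommutativeRing commutativeRing public
  field
    1≉0     : ¬ 1# ≈ 0#
    inverse : ∀ x → ¬ x ≈ 0# → ∃ λ y → x * y ≈ 1#

CharacteristicZero : ∀ {c ℓ} → Field c ℓ → Set ℓ
CharacteristicZero K = ∀ m → m ×′ 1# ≈ 0# → m ≡ 0
  where
  open Field K
  open RawSemiringDefinitions (Semiring.rawSemiring semiring) using () renaming (_×_ to _×′_)

record OrderedField c ℓ ℓ′ : Set (Level.suc (c ⊔ ℓ ⊔ ℓ′)) where
  infix 4 _<_
  field
    fieldStructure : Field c ℓ
  open Field fieldStructure public
  field
    _<_                : Rel Carrier ℓ′
    isStrictTotalOrder : IsStrictTotalOrder _≈_ _<_
    +-monoˡ-<          : ∀ z {x y} → x < y → x + z < y + z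
    *-pos              : ∀ {x y} → 0# < x → 0# < y → 0# < x * y


module LinearAlgebra {c ℓ} (K : Field c ℓ) where

  open Field K hiding (zero)

  VectorSpace : ∀ v ℓv → Set _
  VectorSpace v ℓv = LeftModule ring v ℓv

  private
    variable
      g r s u v w ℓu ℓv ℓw : Level

  infix 1 _⊸_

  record _⊸_ (V : VectorSpace v ℓv) (W : VectorSpace w ℓw) : Set (c ⊔ v ⊔ ℓv ⊔ w ⊔ ℓw) where
    private
      module V = LeftModule V
      module W = LeftModule W
    open LeftModuleMorphisms V.rawLeftModule W.rawLeftModule
    infixl 20 _·_
    field
      _·_    : V.Carrierᴹ → W.Carrierᴹ
      isHomo : IsLeftModuleHomomorphism _·_
    open IsLeftModuleHomomorphism isHomo public

  open _⊸_ public using (_·_)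

  module _ {V : VectorSpace v ℓv} {W : VectorSpace w ℓw} where
    private
      module V = LeftModule V
      module W = LeftModule W

    infix 4 _≗ₗ_

    _≗ₗ_ : Rel (V ⊸ W) (v ⊔ ℓw)
    φ ≗ₗ ψ = ∀ x → (φ · x) W.≈ᴹ (ψ · x)

    mkLinear : (φ : V.Carrierᴹ → W.Carrierᴹ) →
               (∀ {x y} → x V.≈ᴹ y → φ x W.≈ᴹ φ y) →
               (∀ x y → φ (x V.+ᴹ y) W.≈ᴹ φ x W.+ᴹ φ y) →
               (∀ a x → φ (a V.*ₗ x) W.≈ᴹ a W.*ₗ φ x) →
               V ⊸ W
    mkLinear φ φ-cong φ-+ φ-* = record
      { _·_    = φ
      ; isHomo = record
        { +ᴹ-isGroupHomomorphism = record
          { isMonoidHomomorphism = record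
            { isMagmaHomomorphism = record
              { isRelHomomorphism = record { cong = φ-cong }
              ; homo              = φ-+
              }
            ; ε-homo = φ-0
            }
          ; ⁻¹-homo = λ x → GroupProperties.inverseˡ-unique W.+ᴹ-group (φ (V.-ᴹ x)) (φ x)
              (W.≈ᴹ-trans (W.≈ᴹ-sym (φ-+ (V.-ᴹ x) x))
                (W.≈ᴹ-trans (φ-cong (proj₁ V.-ᴹ‿inverse x)) φ-0))
          }
        ; *ₗ-homo = φ-*
        }
      }
      where
      φ-0 : φ V.0ᴹ W.≈ᴹ W.0ᴹ
      φ-0 = W.≈ᴹ-trans (φ-cong (V.≈ᴹ-sym (V.*ₗ-zeroˡ V.0ᴹ)))
              (W.≈ᴹ-trans (φ-* 0# V.0ᴹ) (W.*ₗ-zeroˡ (φ V.0ᴹ)))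

  infixr 9 _∘ₗ_

  _∘ₗ_ : {U : VectorSpace u ℓu} {V : VectorSpace v ℓv} {W : VectorSpace w ℓw} →
         (V ⊸ W) → (U ⊸ V) → (U ⊸ W)
  _∘ₗ_ {W = W} φ ψ = record
    { _·_    = λ x → φ · (ψ · x)
    ; isHomo = Composition.isLeftModuleHomomorphism (LeftModule.≈ᴹ-trans W)
                 (_⊸_.isHomo ψ) (_⊸_.isHomo φ)
    }

  scalars : VectorSpace c ℓ
  scalars = TensorUnit.leftModule

  module _ (V : VectorSpace v ℓv) (W : VectorSpace w ℓw) where
    private
      module V = LeftModule V
      module W = LeftModule W
      module WP = GroupProperties W.+ᴹ-group

    private
      open SetoidReasoning W.≈ᴹ-setoid

      interchange : ∀ x y z t → ((x W.+ᴹ y) W.+ᴹ (z W.+ᴹ t)) W.≈ᴹ ((x W.+ᴹ z) W.+ᴹ (y W.+ᴹ t))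
      interchange x y z t = begin
        (x W.+ᴹ y) W.+ᴹ (z W.+ᴹ t)   ≈⟨ W.+ᴹ-assoc x y _ ⟩
        x W.+ᴹ (y W.+ᴹ (z W.+ᴹ t))   ≈⟨ W.+ᴹ-congˡ (W.+ᴹ-assoc y z t) ⟨
        x W.+ᴹ ((y W.+ᴹ z) W.+ᴹ t)   ≈⟨ W.+ᴹ-congˡ (W.+ᴹ-congʳ (W.+ᴹ-comm y z)) ⟩
        x W.+ᴹ ((z W.+ᴹ y) W.+ᴹ t)   ≈⟨ W.+ᴹ-congˡ (W.+ᴹ-assoc z y t) ⟩
        x W.+ᴹ (z W.+ᴹ (y W.+ᴹ t))   ≈⟨ W.+ᴹ-assoc x z _ ⟨
        (x W.+ᴹ z) W.+ᴹ (y W.+ᴹ t)   ∎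

    Hom : VectorSpace (c ⊔ v ⊔ ℓv ⊔ w ⊔ ℓw) (v ⊔ ℓw)
    Hom = record
      { Carrierᴹ = V ⊸ W
      ; _≈ᴹ_     = _≗ₗ_
      ; _+ᴹ_     = λ φ ψ → mkLinear (λ x → (φ · x) W.+ᴹ (ψ · x))
          (λ e → W.+ᴹ-cong (_⊸_.⟦⟧-cong φ e) (_⊸_.⟦⟧-cong ψ e))
          (λ x y → W.≈ᴹ-trans (W.+ᴹ-cong (_⊸_.+ᴹ-homo φ x y) (_⊸_.+ᴹ-homo ψ x y))
                     (interchange (φ · x) (φ · y) (ψ · x) (ψ · y)))
          (λ a x → W.≈ᴹ-trans (W.+ᴹ-cong (_⊸_.*ₗ-homo φ a x) (_⊸_.*ₗ-homo ψ a x))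
                     (W.≈ᴹ-sym (W.*ₗ-distribˡ a (φ · x) (ψ · x))))
      ; _*ₗ_     = λ a φ → mkLinear (λ x → a W.*ₗ (φ · x))
          (λ e → W.*ₗ-congˡ (_⊸_.⟦⟧-cong φ e))
          (λ x y → W.≈ᴹ-trans (W.*ₗ-congˡ (_⊸_.+ᴹ-homo φ x y)) (W.*ₗ-distribˡ a (φ · x) (φ · y)))
          (λ b x → begin
            a W.*ₗ (φ · (b V.*ₗ x))  ≈⟨ W.*ₗ-congˡ (_⊸_.*ₗ-homo φ b x) ⟩
            a W.*ₗ (b W.*ₗ (φ · x))  ≈⟨ W.*ₗ-assoc a b (φ · x) ⟨
            (a * b) W.*ₗ (φ · x)     ≈⟨ W.*ₗ-congʳ (*-comm a b) ⟩
            (b * a) W.*ₗ (φ · x)     ≈⟨ W.*ₗ-assoc b a (φ · x) ⟩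
            b W.*ₗ (a W.*ₗ (φ · x))  ∎)
      ; 0ᴹ       = mkLinear (λ _ → W.0ᴹ) (λ _ → W.≈ᴹ-refl)
          (λ _ _ → W.≈ᴹ-sym (W.+ᴹ-identityˡ W.0ᴹ))
          (λ a _ → W.≈ᴹ-sym (W.*ₗ-zeroʳ a))
      ; -ᴹ_      = λ φ → mkLinear (λ x → W.-ᴹ (φ · x))
          (λ e → W.-ᴹ‿cong (_⊸_.⟦⟧-cong φ e))
          (λ x y → begin
            W.-ᴹ (φ · (x V.+ᴹ y))               ≈⟨ W.-ᴹ‿cong (_⊸_.+ᴹ-homo φ x y) ⟩
            W.-ᴹ ((φ · x) W.+ᴹ (φ · y))         ≈⟨ WP.⁻¹-anti-homo-∙ (φ · x) (φ · y) ⟩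
            W.-ᴹ (φ · y) W.+ᴹ W.-ᴹ (φ · x)      ≈⟨ W.+ᴹ-comm _ _ ⟩
            W.-ᴹ (φ · x) W.+ᴹ W.-ᴹ (φ · y)      ∎)
          (λ a x → begin
            W.-ᴹ (φ · (a V.*ₗ x))     ≈⟨ W.-ᴹ‿cong (_⊸_.*ₗ-homo φ a x) ⟩
            W.-ᴹ (a W.*ₗ (φ · x))     ≈⟨ WP.inverseˡ-unique _ _ (begin
              (a W.*ₗ (W.-ᴹ (φ · x))) W.+ᴹ (a W.*ₗ (φ · x))  ≈⟨ W.*ₗ-distribˡ a _ _ ⟨
              a W.*ₗ (W.-ᴹ (φ · x) W.+ᴹ (φ · x))             ≈⟨ W.*ₗ-congˡ (proj₁ W.-ᴹ‿inverse _) ⟩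
              a W.*ₗ W.0ᴹ                                    ≈⟨ W.*ₗ-zeroʳ a ⟩
              W.0ᴹ                                           ∎) ⟨
            a W.*ₗ (W.-ᴹ (φ · x))     ∎)
      ; isLeftModule = record
        { isLeftSemimodule = record
          { +ᴹ-isCommutativeMonoid = record
            { isMonoid = record
              { isSemigroup = record
                { isMagma = record
                  { isEquivalence = record
                    { refl  = λ _ → W.≈ᴹ-refl
                    ; sym   = λ e x → W.≈ᴹ-sym (e x)
                    ; trans = λ e e′ x → W.≈ᴹ-trans (e x) (e′ x)
                    }
                  ; ∙-cong = λ e e′ x → W.+ᴹ-cong (e x) (e′ x)
                  }
                ; assoc = λ _ _ _ _ → W.+ᴹ-assoc _ _ _
                }
              ; identity = (λ _ _ → W.+ᴹ-identityˡ _) , (λ _ _ → W.+ᴹ-identityʳ _)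
              }
            ; comm = λ _ _ _ → W.+ᴹ-comm _ _
            }
          ; isPreleftSemimodule = record
            { *ₗ-cong      = λ e e′ x → W.*ₗ-cong e (e′ x)
            ; *ₗ-zeroˡ     = λ _ _ → W.*ₗ-zeroˡ _
            ; *ₗ-distribʳ  = λ _ _ _ _ → W.*ₗ-distribʳ _ _ _
            ; *ₗ-identityˡ = λ _ _ → W.*ₗ-identityˡ _
            ; *ₗ-assoc     = λ _ _ _ _ → W.*ₗ-assoc _ _ _
            ; *ₗ-zeroʳ     = λ _ _ → W.*ₗ-zeroʳ _
            ; *ₗ-distribˡ  = λ _ _ _ _ → W.*ₗ-distribˡ _ _ _
            }
          }
        ; -ᴹ‿cong    = λ e x → W.-ᴹ‿cong (e x)
        ; -ᴹ‿inverse = (λ _ _ → proj₁ W.-ᴹ‿inverse _) , (λ _ _ → proj₂ W.-ᴹ‿inverse _)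
        }
      }

  Dual : VectorSpace v ℓv → VectorSpace (c ⊔ ℓ ⊔ v ⊔ ℓv) (ℓ ⊔ v)
  Dual V = Hom V scalars

  -- Vector spaces given by generators and relations: formal linear expressions,
  -- with the least vector space congruence containing the relations as equality.

  infixl 6 _⊕_
  infixr 7 _⊛_

  data Term (G : Set g) : Set (c ⊔ g) where
    gen : G → Term G
    _⊕_ : Term G → Term G → Term G
    ⊝_  : Term G → Term G
    _⊛_ : Carrier → Term G → Term G
    𝟘   : Term G

  module Presented (G : Set g) (_∼_ : Rel (Term G) r) where

    infix 4 _≋_

    data _≋_ : Rel (Term G) (c ⊔ ℓ ⊔ g ⊔ r) where
      relation  : ∀ {x y} → x ∼ y → x ≋ y
      ≋-refl    : ∀ {x} → x ≋ x
      ≋-sym     : ∀ {x y} → x ≋ y → y ≋ x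
      ≋-trans   : ∀ {x y z} → x ≋ y → y ≋ z → x ≋ z
      ⊕-cong    : ∀ {x x′ y y′} → x ≋ x′ → y ≋ y′ → x ⊕ y ≋ x′ ⊕ y′
      ⊝-cong    : ∀ {x x′} → x ≋ x′ → ⊝ x ≋ ⊝ x′
      ⊛-cong    : ∀ {a b x y} → a ≈ b → x ≋ y → a ⊛ x ≋ b ⊛ y
      ⊕-assoc   : ∀ x y z → (x ⊕ y) ⊕ z ≋ x ⊕ (y ⊕ z)
      ⊕-comm    : ∀ x y → x ⊕ y ≋ y ⊕ x
      ⊕-idˡ     : ∀ x → 𝟘 ⊕ x ≋ x
      ⊝-inverse : ∀ x → (⊝ x) ⊕ x ≋ 𝟘
      ⊛-distribʳ : ∀ x a b → (a + b) ⊛ x ≋ a ⊛ x ⊕ b ⊛ x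
      ⊛-distribˡ : ∀ a x y → a ⊛ (x ⊕ y) ≋ a ⊛ x ⊕ a ⊛ y
      ⊛-assoc   : ∀ a b x → (a * b) ⊛ x ≋ a ⊛ (b ⊛ x)
      ⊛-idˡ     : ∀ x → 1# ⊛ x ≋ x
      ⊛-zeroˡ   : ∀ x → 0# ⊛ x ≋ 𝟘
      ⊛-zeroʳ   : ∀ a → a ⊛ 𝟘 ≋ 𝟘

    space : VectorSpace (c ⊔ g) (c ⊔ ℓ ⊔ g ⊔ r)
    space = record
      { Carrierᴹ = Term G
      ; _≈ᴹ_     = _≋_
      ; _+ᴹ_     = _⊕_
      ; _*ₗ_     = _⊛_
      ; 0ᴹ       = 𝟘
      ; -ᴹ_      = ⊝_
      ; isLeftModule = record
        { isLeftSemimodule = record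
          { +ᴹ-isCommutativeMonoid = record
            { isMonoid = record
              { isSemigroup = record
                { isMagma = record
                  { isEquivalence = record { refl = ≋-refl ; sym = ≋-sym ; trans = ≋-trans }
                  ; ∙-cong = ⊕-cong
                  }
                ; assoc = ⊕-assoc
                }
              ; identity = ⊕-idˡ , λ x → ≋-trans (⊕-comm x 𝟘) (⊕-idˡ x)
              }
            ; comm = ⊕-comm
            }
          ; isPreleftSemimodule = record
            { *ₗ-cong      = ⊛-cong
            ; *ₗ-zeroˡ     = ⊛-zeroˡ
            ; *ₗ-distribʳ  = ⊛-distribʳ
            ; *ₗ-identityˡ = ⊛-idˡ
            ; *ₗ-assoc     = ⊛-assoc
            ; *ₗ-zeroʳ     = ⊛-zeroʳ
            ; *ₗ-distribˡ  = ⊛-distribˡ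
            }
          }
        ; -ᴹ‿cong    = ⊝-cong
        ; -ᴹ‿inverse = ⊝-inverse , λ x → ≋-trans (⊕-comm x (⊝ x)) (⊝-inverse x)
        }
      }

    module _ (W : VectorSpace w ℓw) (φ : G → LeftModule.Carrierᴹ W) where
      private module W = LeftModule W

      eval : Term G → W.Carrierᴹ
      eval (gen x) = φ x
      eval (x ⊕ y) = eval x W.+ᴹ eval y
      eval (⊝ x)   = W.-ᴹ eval x
      eval (a ⊛ x) = a W.*ₗ eval x
      eval 𝟘       = W.0ᴹ

      module _ (respects : ∀ {x y} → x ∼ y → eval x W.≈ᴹ eval y) where

        eval-cong : ∀ {x y} → x ≋ y → eval x W.≈ᴹ eval y
        eval-cong (relation e)      = respects e
        eval-cong ≋-refl            = W.≈ᴹ-refl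
        eval-cong (≋-sym e)         = W.≈ᴹ-sym (eval-cong e)
        eval-cong (≋-trans e e′)    = W.≈ᴹ-trans (eval-cong e) (eval-cong e′)
        eval-cong (⊕-cong e e′)     = W.+ᴹ-cong (eval-cong e) (eval-cong e′)
        eval-cong (⊝-cong e)        = W.-ᴹ‿cong (eval-cong e)
        eval-cong (⊛-cong e e′)     = W.*ₗ-cong e (eval-cong e′)
        eval-cong (⊕-assoc x y z)   = W.+ᴹ-assoc _ _ _
        eval-cong (⊕-comm x y)      = W.+ᴹ-comm _ _
        eval-cong (⊕-idˡ x)         = W.+ᴹ-identityˡ _
        eval-cong (⊝-inverse x)     = proj₁ W.-ᴹ‿inverse _
        eval-cong (⊛-distribʳ x a b) = W.*ₗ-distribʳ _ _ _
        eval-cong (⊛-distribˡ a x y) = W.*ₗ-distribˡ _ _ _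
        eval-cong (⊛-assoc a b x)   = W.*ₗ-assoc _ _ _
        eval-cong (⊛-idˡ x)         = W.*ₗ-identityˡ _
        eval-cong (⊛-zeroˡ x)       = W.*ₗ-zeroˡ _
        eval-cong (⊛-zeroʳ a)       = W.*ₗ-zeroʳ _

        lift : space ⊸ W
        lift = mkLinear eval eval-cong (λ _ _ → W.≈ᴹ-refl) (λ _ _ → W.≈ᴹ-refl)

    module _ {W : VectorSpace w ℓw} (φ ψ : space ⊸ W) where
      private
        module W = LeftModule W
        module φ = _⊸_ φ
        module ψ = _⊸_ ψ

      ≗ₗ-on-generators : (∀ x → (φ · gen x) W.≈ᴹ (ψ · gen x)) → φ ≗ₗ ψ
      ≗ₗ-on-generators e (gen x) = e x
      ≗ₗ-on-generators e (x ⊕ y) = W.≈ᴹ-trans (φ.+ᴹ-homo x y) (W.≈ᴹ-trans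
        (W.+ᴹ-cong (≗ₗ-on-generators e x) (≗ₗ-on-generators e y)) (W.≈ᴹ-sym (ψ.+ᴹ-homo x y)))
      ≗ₗ-on-generators e (⊝ x)   = W.≈ᴹ-trans (φ.-ᴹ-homo x) (W.≈ᴹ-trans
        (W.-ᴹ‿cong (≗ₗ-on-generators e x)) (W.≈ᴹ-sym (ψ.-ᴹ-homo x)))
      ≗ₗ-on-generators e (a ⊛ x) = W.≈ᴹ-trans (φ.*ₗ-homo a x) (W.≈ᴹ-trans
        (W.*ₗ-congˡ (≗ₗ-on-generators e x)) (W.≈ᴹ-sym (ψ.*ₗ-homo a x)))
      ≗ₗ-on-generators e 𝟘       = W.≈ᴹ-trans φ.0ᴹ-homo (W.≈ᴹ-sym ψ.0ᴹ-homo)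

  module FreeSpace (A : Setoid g s) where
    private module A = Setoid A

    data SameBasisElement : Rel (Term A.Carrier) (c ⊔ g ⊔ s) where
      same : ∀ {x y} → x A.≈ y → SameBasisElement (gen x) (gen y)

    open Presented A.Carrier SameBasisElement public using (≗ₗ-on-generators)
      renaming (space to Free)
    open Presented A.Carrier SameBasisElement

    module _ {W : VectorSpace w ℓw} where
      private module W = LeftModule W

      extend : (φ : A.Carrier → W.Carrierᴹ) → (∀ {x y} → x A.≈ y → φ x W.≈ᴹ φ y) → Free ⊸ W
      extend φ φ-cong = lift W φ λ { (same e) → φ-cong e }

    gen-cong : ∀ {x y} → x A.≈ y → LeftModule._≈ᴹ_ Free (gen x) (gen y)
    gen-cong e = relation (same e)

  open FreeSpace public using (Free; extend; gen-cong)

  module TensorProduct {k : ℕ} (V : Fin k → VectorSpace v ℓv) where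
    private module V j = LeftModule (V j)

    Family : Set v
    Family = ∀ j → V.Carrierᴹ j

    AgreeExceptAt : Fin k → Rel Family ℓv
    AgreeExceptAt j x y = ∀ i → i ≢ j → V._≈ᴹ_ i (x i) (y i)

    data Multilinear : Rel (Term Family) (c ⊔ v ⊔ ℓv) where
      ⊗-cong  : ∀ {x y} → (∀ j → V._≈ᴹ_ j (x j) (y j)) → Multilinear (gen x) (gen y)
      ⊗-add   : ∀ j {x y z} → V._≈ᴹ_ j (z j) (V._+ᴹ_ j (x j) (y j)) →
                AgreeExceptAt j z x → AgreeExceptAt j z y →
                Multilinear (gen z) (gen x ⊕ gen y)
      ⊗-scale : ∀ j a {x z} → V._≈ᴹ_ j (z j) (V._*ₗ_ j a (x j)) → AgreeExceptAt j z x →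
                Multilinear (gen z) (a ⊛ gen x)

    open Presented Family Multilinear public using () renaming (space to ⨂)

  open TensorProduct public using (⨂; ⊗-cong; ⊗-add; ⊗-scale)

  module _ {k : ℕ} {V : Fin k → VectorSpace v ℓv} {W : Fin k → VectorSpace w ℓw}
           (φ : ∀ j → V j ⊸ W j) where
    private
      module W j = LeftModule (W j)
      module V⊗ = Presented (TensorProduct.Family V) (TensorProduct.Multilinear V)
      module W⊗ = Presented (TensorProduct.Family W) (TensorProduct.Multilinear W)

    ⨂-map : ⨂ V ⊸ ⨂ W
    ⨂-map = V⊗.lift (⨂ W) (λ x → gen (λ j → φ j · x j)) λ where
      (⊗-cong e)        → W⊗.relation (⊗-cong λ j → _⊸_.⟦⟧-cong (φ j) (e j))
      (⊗-add j e p q)   → W⊗.relation (⊗-add j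
        (W.≈ᴹ-trans j (_⊸_.⟦⟧-cong (φ j) e) (_⊸_.+ᴹ-homo (φ j) _ _))
        (λ i i≢j → _⊸_.⟦⟧-cong (φ i) (p i i≢j)) (λ i i≢j → _⊸_.⟦⟧-cong (φ i) (q i i≢j)))
      (⊗-scale j a e p) → W⊗.relation (⊗-scale j a
        (W.≈ᴹ-trans j (_⊸_.⟦⟧-cong (φ j) e) (_⊸_.*ₗ-homo (φ j) a _))
        (λ i i≢j → _⊸_.⟦⟧-cong (φ i) (p i i≢j)))

  open Sum *-commutativeMonoid public using ()
    renaming (sum to Π; sum-cong-≋ to Π-cong)

  Π-add : ∀ {k} (j : Fin k) {x y z : Fin k → Carrier} → z j ≈ x j + y j →
          (∀ i → i ≢ j → z i ≈ x i) → (∀ i → i ≢ j → z i ≈ y i) → Π z ≈ Π x + Π y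
  Π-add zero {x} {y} {z} e p q = begin
    z zero * Π (z ∘ suc)                                 ≈⟨ *-congʳ e ⟩
    (x zero + y zero) * Π (z ∘ suc)                      ≈⟨ distribʳ _ _ _ ⟩
    x zero * Π (z ∘ suc) + y zero * Π (z ∘ suc)
      ≈⟨ +-cong (*-congˡ (Π-cong λ i → p (suc i) λ ())) (*-congˡ (Π-cong λ i → q (suc i) λ ())) ⟩
    x zero * Π (x ∘ suc) + y zero * Π (y ∘ suc)      ∎
    where open SetoidReasoning setoid
  Π-add (suc j) {x} {y} {z} e p q = begin
    z zero * Π (z ∘ suc)
      ≈⟨ *-congˡ (Π-add j e (λ i i≢j → p (suc i) (i≢j ∘ Fin.suc-injective))
                            (λ i i≢j → q (suc i) (i≢j ∘ Fin.suc-injective))) ⟩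
    z zero * (Π (x ∘ suc) + Π (y ∘ suc))             ≈⟨ distribˡ _ _ _ ⟩
    z zero * Π (x ∘ suc) + z zero * Π (y ∘ suc)
      ≈⟨ +-cong (*-congʳ (p zero λ ())) (*-congʳ (q zero λ ())) ⟩
    x zero * Π (x ∘ suc) + y zero * Π (y ∘ suc)      ∎
    where open SetoidReasoning setoid

  Π-scale : ∀ {k} (j : Fin k) a {x z : Fin k → Carrier} → z j ≈ a * x j →
            (∀ i → i ≢ j → z i ≈ x i) → Π z ≈ a * Π x
  Π-scale zero a {x} {z} e p =
    trans (*-cong e (Π-cong λ i → p (suc i) λ ())) (*-assoc a _ _)
  Π-scale (suc j) a {x} {z} e p = begin
    z zero * Π (z ∘ suc)
      ≈⟨ *-cong (p zero λ ()) (Π-scale j a e (λ i i≢j → p (suc i) (i≢j ∘ Fin.suc-injective))) ⟩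
    x zero * (a * Π (x ∘ suc))   ≈⟨ *-assoc _ _ _ ⟨
    (x zero * a) * Π (x ∘ suc)   ≈⟨ *-congʳ (*-comm _ _) ⟩
    (a * x zero) * Π (x ∘ suc)   ≈⟨ *-assoc _ _ _ ⟩
    a * (x zero * Π (x ∘ suc))   ∎
    where open SetoidReasoning setoid

private
  variable
    n k : ℕ

-- Partitions of Fin n.  The list of blocks is an enumeration S₁, …, Sₖ of an
-- unordered set; partitions are compared up to reordering, by _≈ᴾ_.

Disjoint : Rel (Subset n) 0ℓ
Disjoint A B = Empty (A ∩ B)

record Partition (n : ℕ) : Set where
  field
    blocks   : List (Subset n)
    nonempty : All Nonempty blocks
    disjoint : AllPairs Disjoint blocks
    cover    : ∀ i → Any (i ∈_) blocks

  size : ℕ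
  size = length blocks

  block : Fin size → Subset n
  block = lookup blocks

open Partition public

infix 4 _≈ᴾ_ _≼_

_≈ᴾ_ : Rel (Partition n) 0ℓ
P ≈ᴾ Q = blocks P ↭ blocks Q

_≼_ : Rel (Partition n) 0ℓ
Q ≼ P = All (λ B → Any (B ⊆_) (blocks P)) (blocks Q)

≼-refl : (P : Partition n) → P ≼ P
≼-refl P = All.tabulate (Any.map λ { ≡.refl → id })

Redn : Partition n → Subset n → Subset n
Redn P E = E ─ ⋃ (filter (Subset._⊆? E) (blocks P))

infix 4 _≡_mod_

_≡_mod_ : Subset n → Subset n → Partition n → Set
E ≡ S mod P = Redn P E ≡ Redn P S

_≡_mod?_ : (E S : Subset n) (P : Partition n) → Dec (E ≡ S mod P)
E ≡ S mod? P = Vec.≡-dec Bool._≟_ (Redn P E) (Redn P S)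

∈⋃⁺ : ∀ {i : Fin n} {Bs} → Any (i ∈_) Bs → i ∈ ⋃ Bs
∈⋃⁺ (here i∈B)  = Subset.x∈p∪q⁺ (inj₁ i∈B)
∈⋃⁺ (there i∈Bs) = Subset.x∈p∪q⁺ (inj₂ (∈⋃⁺ i∈Bs))

∈⋃⁻ : ∀ {i : Fin n} Bs → i ∈ ⋃ Bs → Any (i ∈_) Bs
∈⋃⁻ []       i∈ = ⊥-elim (Subset.∉⊥ i∈)
∈⋃⁻ (B ∷ Bs) i∈ = [ here , there ∘ ∈⋃⁻ Bs ]′ (Subset.x∈p∪q⁻ B (⋃ Bs) i∈)

∈─⁻ : ∀ {i : Fin n} (p q : Subset n) → i ∈ p ─ q → i ∉ q
∈─⁻ (true ∷ p) (false ∷ q) here      ()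
∈─⁻ (_ ∷ p)    (_ ∷ q)     (there i∈) (there i∈q) = ∈─⁻ p q i∈ i∈q

AllPairs-resp-↭ : ∀ {a r} {A : Set a} {R : Rel A r} → (∀ {x y} → R x y → R y x) →
                  ∀ {xs ys} → xs ↭ ys → AllPairs R xs → AllPairs R ys
AllPairs-resp-↭ R-sym _↭_.refl        ps = ps
AllPairs-resp-↭ R-sym (prep x e)      (p ∷ ps) = ↭.All-resp-↭ e p ∷ AllPairs-resp-↭ R-sym e ps
AllPairs-resp-↭ R-sym (swap x y e)    ((r ∷ p) ∷ q ∷ ps) =
  (R-sym r ∷ ↭.All-resp-↭ e q) ∷ ↭.All-resp-↭ e p ∷ AllPairs-resp-↭ R-sym e ps
AllPairs-resp-↭ R-sym (_↭_.trans e f) ps = AllPairs-resp-↭ R-sym f (AllPairs-resp-↭ R-sym e ps)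

AllPairs-lookup : ∀ {a r} {A : Set a} {R : Rel A r} → (∀ {x y} → R x y → R y x) →
                  ∀ {xs} → AllPairs R xs → ∀ {i j} → i ≢ j → R (lookup xs i) (lookup xs j)
AllPairs-lookup R-sym (p ∷ ps) {zero}  {zero}  i≢j = contradiction ≡.refl i≢j
AllPairs-lookup R-sym (p ∷ ps) {zero}  {suc j} i≢j = All.lookup p (∈ˡ.∈-lookup j)
AllPairs-lookup R-sym (p ∷ ps) {suc i} {zero}  i≢j = R-sym (All.lookup p (∈ˡ.∈-lookup i))
AllPairs-lookup R-sym (p ∷ ps) {suc i} {suc j} i≢j = AllPairs-lookup R-sym ps (i≢j ∘ cong suc)

Disjoint-sym : {A B : Subset n} → Disjoint A B → Disjoint B A
Disjoint-sym {A = A} {B} d (i , i∈) = d (i , Subset.x∈p∩q⁺ (proj₂ both , proj₁ both))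
  where both = Subset.x∈p∩q⁻ B A i∈

∉-Disjoint : ∀ {A B : Subset n} {i} → Disjoint A B → i ∈ A → i ∉ B
∉-Disjoint d i∈A i∈B = d (_ , Subset.x∈p∩q⁺ (i∈A , i∈B))

Disjoint-⊆ : (A A′ : Subset n) {B : Subset n} → A ⊆ A′ → Disjoint A′ B → Disjoint A B
Disjoint-⊆ A A′ {B} A⊆ d (i , i∈) =
  let i∈A , i∈B = Subset.x∈p∩q⁻ A B i∈ in ∉-Disjoint d (A⊆ i∈A) i∈B

∈-unique : ∀ {Bs : List (Subset n)} → AllPairs Disjoint Bs → ∀ {A B i} →
           A ∈ˡ Bs → B ∈ˡ Bs → i ∈ A → i ∈ B → A ≡ B
∈-unique (p ∷ ps) (here ≡.refl) (here ≡.refl) i∈A i∈B = ≡.refl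
∈-unique (p ∷ ps) (here ≡.refl) (there B∈)    i∈A i∈B = ⊥-elim (∉-Disjoint (All.lookup p B∈) i∈A i∈B)
∈-unique (p ∷ ps) (there A∈)    (here ≡.refl) i∈A i∈B = ⊥-elim (∉-Disjoint (All.lookup p A∈) i∈B i∈A)
∈-unique (p ∷ ps) (there A∈)    (there B∈)    i∈A i∈B = ∈-unique ps A∈ B∈ i∈A i∈B

blockOf : (P : Partition n) (i : Fin n) → ∃ λ B → B ∈ˡ blocks P × i ∈ B
blockOf P i = let B , B∈ , i∈B = find (cover P i) in B , B∈ , i∈B

∈-Redn⁺ : (P : Partition n) {E B : Subset n} {i : Fin n} →
          i ∈ E → B ∈ˡ blocks P → i ∈ B → B ⊈ E → i ∈ Redn P E
∈-Redn⁺ P {E} {B} {i} i∈E B∈ i∈B B⊈E = Subset.x∈p∧x∉q⇒x∈p─q i∈E i∉⋃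
  where
  i∉⋃ : i ∉ ⋃ (filter (Subset._⊆? E) (blocks P))
  i∉⋃ i∈ =
    let B′ , B′∈f , i∈B′ = find (∈⋃⁻ _ i∈)
        B′∈ , B′⊆E = ∈ˡ.∈-filter⁻ (Subset._⊆? E) {xs = blocks P} B′∈f
    in B⊈E (subst (_⊆ E) (∈-unique (disjoint P) B′∈ B∈ i∈B′ i∈B) B′⊆E)

∈-Redn⇒∈ : (P : Partition n) {E : Subset n} {i : Fin n} → i ∈ Redn P E → i ∈ E
∈-Redn⇒∈ P {E} = Subset.p─q⊆p E _

∈-Redn⇒⊈ : (P : Partition n) {E B : Subset n} {i : Fin n} →
           i ∈ Redn P E → B ∈ˡ blocks P → i ∈ B → B ⊈ E
∈-Redn⇒⊈ P {E} i∈ B∈ i∈B B⊆E =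
  ∈─⁻ E _ i∈ (∈⋃⁺ (lose (∈ˡ.∈-filter⁺ (Subset._⊆? E) B∈ B⊆E) i∈B))

Saturated : Partition n → Subset n → Set
Saturated Q S = All (λ B → B ⊆ S ⊎ Disjoint B S) (blocks Q)

≼⇒Saturated : (P Q : Partition n) → Q ≼ P → ∀ j → Saturated Q (block P j)
≼⇒Saturated P Q Q≼P j = All.map saturated Q≼P
  where
  saturated : ∀ {B} → Any (B ⊆_) (blocks P) → B ⊆ block P j ⊎ Disjoint B (block P j)
  saturated {B} B⊆P with Subset.nonempty? (B ∩ block P j)
  ... | no  d        = inj₂ d
  ... | yes (i , i∈) =
    let S , S∈ , B⊆S = find B⊆P
        i∈B , i∈Sⱼ   = Subset.x∈p∩q⁻ B (block P j) i∈
    in inj₁ (subst (B ⊆_) (∈-unique (disjoint P) S∈ (∈ˡ.∈-lookup j) (B⊆S i∈B) i∈Sⱼ) B⊆S)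

singletonsOutside : Subset n → List (Subset n)
singletonsOutside {n} S = map ⁅_⁆ (filter (λ i → ¬? (i Subset.∈? S)) (allFin n))

module _ (S : Subset n) where

  singletons-nonempty : All Nonempty (singletonsOutside S)
  singletons-nonempty = All.map⁺ (All.universal (λ i → i , Subset.x∈⁅x⁆ i) _)

  singletons-disjoint : AllPairs Disjoint (singletonsOutside S)
  singletons-disjoint = AllPairs.map⁺ (AllPairs.filter⁺ _ (AllPairs.map distinct (Unique.allFin⁺ n)))
    where
    distinct : {i j : Fin n} → i ≢ j → Disjoint ⁅ i ⁆ ⁅ j ⁆
    distinct {i} {j} i≢j (x , x∈) =
      let x∈i , x∈j = Subset.x∈p∩q⁻ ⁅ i ⁆ ⁅ j ⁆ x∈
      in i≢j (≡.trans (≡.sym (Subset.x∈⁅y⁆⇒x≡y i x∈i)) (Subset.x∈⁅y⁆⇒x≡y j x∈j))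

  singletons-outside : All (Disjoint S) (singletonsOutside S)
  singletons-outside = All.map⁺ (All.map outside (All.all-filter _ (allFin n)))
    where
    outside : {i : Fin n} → i ∉ S → Disjoint S ⁅ i ⁆
    outside {i} i∉S (x , x∈) =
      let x∈S , x∈i = Subset.x∈p∩q⁻ S ⁅ i ⁆ x∈
      in i∉S (subst (_∈ S) (Subset.x∈⁅y⁆⇒x≡y i x∈i) x∈S)

  singletons-cover : ∀ {i} → i ∉ S → Any (i ∈_) (singletonsOutside S)
  singletons-cover {i} i∉S = lose
    (∈ˡ.∈-map⁺ ⁅_⁆ (∈ˡ.∈-filter⁺ _ (∈ˡ.∈-allFin i) i∉S)) (Subset.x∈⁅x⁆ i)

-- isolate S is ᴵS.
isolate : (S : Subset n) → Nonempty S → Partition n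
isolate S S≢∅ = record
  { blocks   = S ∷ singletonsOutside S
  ; nonempty = S≢∅ ∷ singletons-nonempty S
  ; disjoint = singletons-outside S ∷ singletons-disjoint S
  ; cover    = λ i → case i Subset.∈? S of λ where
      (yes i∈S) → here i∈S
      (no  i∉S) → there (singletons-cover S i∉S)
  }

-- The blocks of Q contained in S, and the singletons outside S.
_↾_by_ : (Q : Partition n) (S : Subset n) → Saturated Q S → Partition n
Q ↾ S by sat = record
  { blocks   = inside ++ singletonsOutside S
  ; nonempty = All.++⁺ (All.filter⁺ (Subset._⊆? S) (nonempty Q)) (singletons-nonempty S)
  ; disjoint = AllPairs.++⁺ (AllPairs.filter⁺ (Subset._⊆? S) (disjoint Q)) (singletons-disjoint S)
      (All.map apart (All.all-filter (Subset._⊆? S) (blocks Q)))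
  ; cover    = λ i → case i Subset.∈? S of λ where
      (yes i∈S) → Any.++⁺ˡ (covered i∈S)
      (no  i∉S) → Any.++⁺ʳ inside (singletons-cover S i∉S)
  }
  where
  inside : List (Subset _)
  inside = filter (Subset._⊆? S) (blocks Q)

  apart : ∀ {B} → B ⊆ S → All (Disjoint B) (singletonsOutside S)
  apart {B} B⊆S = All.map (Disjoint-⊆ B S B⊆S) (singletons-outside S)

  covered : ∀ {i} → i ∈ S → Any (i ∈_) inside
  covered {i} i∈S =
    let B , B∈ , i∈B = blockOf Q i
    in case All.lookup sat B∈ of λ where
         (inj₁ B⊆S) → lose (∈ˡ.∈-filter⁺ (Subset._⊆? S) B∈ B⊆S) i∈B
         (inj₂ d)   → ⊥-elim (∉-Disjoint d i∈B i∈S)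

module _ {a p} {A : Set a} {Pr : Pred A p} (Pr? : ∀ x → Dec (Pr x)) where

  filter-concat : (f : Fin k → List A) (j : Fin k) → All Pr (f j) →
                  (∀ i → i ≢ j → All (¬_ ∘ Pr) (f i)) →
                  filter Pr? (concat (tabulate f)) ≡ f j
  filter-concat {k = suc k} f zero all none = begin
    filter Pr? (f zero ++ fs)             ≡⟨ List.filter-++ Pr? (f zero) fs ⟩
    filter Pr? (f zero) ++ filter Pr? fs  ≡⟨ cong₂ _++_ (List.filter-all Pr? all) (List.filter-none Pr? fs-none) ⟩
    f zero ++ []                          ≡⟨ List.++-identityʳ (f zero) ⟩
    f zero                                ∎
    where
    open ≡.≡-Reasoning
    fs = concat (tabulate (f ∘ suc))
    fs-none = All.concat⁺ (All.tabulate⁺ {f = f ∘ suc} λ i → none (suc i) λ ())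
  filter-concat {k = suc k} f (suc j) all none =
    ≡.trans (List.filter-++ Pr? (f zero) _)
      (cong₂ _++_ (List.filter-none Pr? (none zero λ ()))
                  (filter-concat (f ∘ suc) j all (λ i i≢j → none (suc i) (i≢j ∘ Fin.suc-injective))))

concat-singletons : ∀ {a} {A : Set a} (xs : List A) → concat (tabulate ([_] ∘ lookup xs)) ≡ xs
concat-singletons []       = ≡.refl
concat-singletons (x ∷ xs) = cong (x ∷_) (concat-singletons xs)

⊈-Disjoint : {B S : Subset n} → Nonempty B → Disjoint B S → B ⊈ S
⊈-Disjoint (i , i∈B) d B⊆S = ∉-Disjoint d i∈B (B⊆S i∈B)

block-nonempty : (P : Partition n) (j : Fin (size P)) → Nonempty (block P j)
block-nonempty P j = All.lookup (nonempty P) (∈ˡ.∈-lookup j)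

-- component P Q Q≼P j is ᴵQⱼ.
component : (P Q : Partition n) → Q ≼ P → Fin (size P) → Partition n
component P Q Q≼P j = Q ↾ block P j by ≼⇒Saturated P Q Q≼P j

-- ᴵPⱼ = ᴵSⱼ.
isolate≈component : (P : Partition n) → ∀ j →
                    isolate (block P j) (block-nonempty P j) ≈ᴾ component P P (≼-refl P) j
isolate≈component P j = ↭-reflexive (cong (_++ singletonsOutside (block P j)) (≡.sym (begin
  filter (Subset._⊆? block P j) (blocks P)
    ≡⟨ cong (filter _) (concat-singletons (blocks P)) ⟨
  filter (Subset._⊆? block P j) (concat (tabulate ([_] ∘ block P)))
    ≡⟨ filter-concat (Subset._⊆? block P j) ([_] ∘ block P) j (id ∷ [])
         (λ i i≢j → ⊈-Disjoint (block-nonempty P i)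
            (AllPairs-lookup Disjoint-sym (disjoint P) i≢j) ∷ []) ⟩
  [ block P j ] ∎)))
  where open ≡.≡-Reasoning

-- Planar full binary trees over S, with leaves labelled by the blocks of a
-- partition of S.

data Tree {n : ℕ} : Subset n → Set where
  stick : (S : Subset n) → Nonempty S → Tree S
  node  : ∀ {C D} → Disjoint C D → Tree C → Tree D → Tree (C ∪ D)

leaves : {S : Subset n} → Tree S → List (Subset n)
leaves (stick S _)  = [ S ]
leaves (node _ l r) = leaves l ++ leaves r

leaves-⊆ : {S : Subset n} (t : Tree S) → All (_⊆ S) (leaves t)
leaves-⊆ (stick S _)          = id ∷ []
leaves-⊆ (node {C} {D} _ l r) = All.++⁺
  (All.map (λ {B} (B⊆C : B ⊆ C) {_} i∈B → Subset.p⊆p∪q D (B⊆C i∈B)) (leaves-⊆ l))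
  (All.map (λ {B} (B⊆D : B ⊆ D) {_} i∈B → Subset.q⊆p∪q C D (B⊆D i∈B)) (leaves-⊆ r))

leaves-nonempty : {S : Subset n} (t : Tree S) → All Nonempty (leaves t)
leaves-nonempty (stick S S≢∅) = S≢∅ ∷ []
leaves-nonempty (node _ l r)  = All.++⁺ (leaves-nonempty l) (leaves-nonempty r)

tree-nonempty : {S : Subset n} → Tree S → Nonempty S
tree-nonempty (stick S S≢∅)        = S≢∅
tree-nonempty (node {C} {D} _ l r) = let i , i∈C = tree-nonempty l in i , Subset.p⊆p∪q D i∈C

data Node {n : ℕ} : {S : Subset n} → Tree S → Set where
  root  : ∀ {C D} {d : Disjoint C D} {l r} → Node (node d l r)
  left  : ∀ {C D} {d : Disjoint C D} {l r} → Node l → Node (node d l r)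
  right : ∀ {C D} {d : Disjoint C D} {l r} → Node r → Node (node d l r)

infix 4 _◁_

-- x ◁ y: y is a descendant of x, y ≠ x.
data _◁_ {n : ℕ} : {S : Subset n} {t : Tree S} → Rel (Node t) 0ℓ where
  root◁left   : ∀ {C D} {d : Disjoint C D} {l r} {y : Node l} → root {d = d} {l} {r} ◁ left y
  root◁right  : ∀ {C D} {d : Disjoint C D} {l r} {y : Node r} → root {d = d} {l} {r} ◁ right y
  left◁left   : ∀ {C D} {d : Disjoint C D} {l r} {x y : Node l} → x ◁ y → left {d = d} {l} {r} x ◁ left y
  right◁right : ∀ {C D} {d : Disjoint C D} {l r} {x y : Node r} → x ◁ y → right {d = d} {l} {r} x ◁ right y

leftOf rightOf : {S : Subset n} {t : Tree S} → Node t → Subset n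
leftOf  {t = node {C} {D} _ l r} root      = C
leftOf  {t = node {C} {D} _ l r} (left x)  = leftOf x
leftOf  {t = node {C} {D} _ l r} (right x) = leftOf x
rightOf {t = node {C} {D} _ l r} root      = D
rightOf {t = node {C} {D} _ l r} (left x)  = rightOf x
rightOf {t = node {C} {D} _ l r} (right x) = rightOf x

infix 4 _≟ᴺ_

_≟ᴺ_ : {S : Subset n} {t : Tree S} → DecidableEquality (Node t)
root    ≟ᴺ root    = yes ≡.refl
root    ≟ᴺ left _  = no λ ()
root    ≟ᴺ right _ = no λ ()
left _  ≟ᴺ root    = no λ ()
left x  ≟ᴺ left y  with x ≟ᴺ y
... | yes ≡.refl = yes ≡.refl
... | no  x≢y    = no λ { ≡.refl → x≢y ≡.refl }
left _  ≟ᴺ right _ = no λ ()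
right _ ≟ᴺ root    = no λ ()
right _ ≟ᴺ left _  = no λ ()
right x ≟ᴺ right y with x ≟ᴺ y
... | yes ≡.refl = yes ≡.refl
... | no  x≢y    = no λ { ≡.refl → x≢y ≡.refl }

module Family {S : Fin k → Subset n} (tree : ∀ j → Tree (S j)) where

  ForestNode : Set
  ForestNode = Σ (Fin k) (Node ∘ tree)

  infix 4 _◁ᶠ_

  data _◁ᶠ_ : Rel ForestNode 0ℓ where
    within : ∀ j {x y : Node (tree j)} → x ◁ y → (j , x) ◁ᶠ (j , y)

  _≟ᶠ_ : DecidableEquality ForestNode
  (i , x) ≟ᶠ (j , y) with i Fin.≟ j
  ... | no  i≢j = no λ { ≡.refl → i≢j ≡.refl }
  ... | yes ≡.refl with x ≟ᴺ y
  ...   | yes ≡.refl = yes ≡.refl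
  ...   | no  x≢y    = no λ { ≡.refl → x≢y ≡.refl }

  -- A linear order on the finite set of nodes, given by listing the nodes.
  record Layering : Set where
    field
      order         : List ForestNode
      unique        : Unique order
      complete      : ∀ x → x ∈ˡ order
      parents-first : AllPairs (λ x y → ¬ y ◁ᶠ x) order

open Family using (Layering)

record LayeredForest (P Q : Partition n) : Set where
  field
    tree     : ∀ j → Tree (block P j)
    labels   : concat (tabulate (leaves ∘ tree)) ↭ blocks Q
    layering : Layering tree

  open Layering layering public

forest⇒≼ : {P Q : Partition n} → LayeredForest P Q → Q ≼ P
forest⇒≼ {P = P} F = ↭.All-resp-↭ labels (All.concat⁺ (All.tabulate⁺ λ j →
  All.map (λ {B} (B⊆Sⱼ : B ⊆ block P j) → lose {P = B ⊆_} (∈ˡ.∈-lookup j) B⊆Sⱼ) (leaves-⊆ (tree j))))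
  where open LayeredForest F

-- The layered forest ᴵSⱼ ← ᴵQⱼ.

module Completion {n} {P Q : Partition n} (F : LayeredForest P Q) (j : Fin (size P)) where

  open LayeredForest F
  open Family using (_◁ᶠ_; within)

  S : Subset n
  S = block P j

  source target : Partition n
  source = isolate S (block-nonempty P j)
  target = component P Q (forest⇒≼ F) j

  completedTree : ∀ i → Tree (block source i)
  completedTree zero    = tree j
  completedTree (suc i) = stick _ (All.lookup (singletons-nonempty S) (∈ˡ.∈-lookup i))

  private
    Nodes Nodes′ : Set
    Nodes  = Family.ForestNode tree
    Nodes′ = Family.ForestNode completedTree

  select : Nodes → Maybe Nodes′
  select (i , x) with i Fin.≟ j
  ... | yes ≡.refl = just (zero , x)
  ... | no  _      = nothing

  select-j : ∀ x → select (j , x) ≡ just (zero , x)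
  select-j x with j Fin.≟ j
  ... | yes ≡.refl = ≡.refl
  ... | no  j≢j    = contradiction ≡.refl j≢j

  select⁻ : ∀ x {y} → select x ≡ just y → ∃ λ z → x ≡ (j , z) × y ≡ (zero , z)
  select⁻ (i , x) e with i Fin.≟ j
  select⁻ (i , x) ≡.refl | yes ≡.refl = x , ≡.refl , ≡.refl

  ∈-select : ∀ {x y} xs → x ∈ˡ xs → select x ≡ just y → y ∈ˡ mapMaybe select xs
  ∈-select (x ∷ xs) (here ≡.refl) e rewrite e = here ≡.refl
  ∈-select (z ∷ xs) (there x∈)    e with select z
  ... | just _  = there (∈-select xs x∈ e)
  ... | nothing = ∈-select xs x∈ e

  module _ {R : Rel Nodes 0ℓ} {R′ : Rel Nodes′ 0ℓ}
           (preserves : ∀ {x y x′ y′} → select x ≡ just x′ → select y ≡ just y′ → R x y → R′ x′ y′) where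

    select-All : ∀ {x x′} xs → select x ≡ just x′ → All (R x) xs → All (R′ x′) (mapMaybe select xs)
    select-All []       e []       = []
    select-All (y ∷ xs) e (r ∷ rs) with select y in e′
    ... | just _  = preserves e e′ r ∷ select-All xs e rs
    ... | nothing = select-All xs e rs

    select-AllPairs : ∀ {xs} → AllPairs R xs → AllPairs R′ (mapMaybe select xs)
    select-AllPairs []                 = []
    select-AllPairs {x ∷ xs} (r ∷ rs) with select x in e
    ... | just _  = select-All xs e r ∷ select-AllPairs rs
    ... | nothing = select-AllPairs rs

  completedLayering : Layering completedTree
  completedLayering = record
    { order         = mapMaybe select order
    ; unique        = select-AllPairs distinct unique
    ; complete      = λ { (zero , x) → ∈-select order (complete (j , x)) (select-j x) }
    ; parents-first = select-AllPairs ordered parents-first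
    }
    where
    distinct : ∀ {x y x′ y′} → select x ≡ just x′ → select y ≡ just y′ → x ≢ y → x′ ≢ y′
    distinct {x} {y} e e′ x≢y x′≡y′ with select⁻ x e | select⁻ y e′
    distinct e e′ x≢y ≡.refl | z , ≡.refl , ≡.refl | .z , ≡.refl , ≡.refl = x≢y ≡.refl

    ordered : ∀ {x y x′ y′} → select x ≡ just x′ → select y ≡ just y′ →
              ¬ Family._◁ᶠ_ tree y x → ¬ Family._◁ᶠ_ completedTree y′ x′
    ordered {x} {y} e e′ y⋪x y′◁x′ with select⁻ x e | select⁻ y e′
    ordered e e′ y⋪x (within .zero y◁x) | z , ≡.refl , ≡.refl | w , ≡.refl , ≡.refl = y⋪x (within j y◁x)

  complete-at : LayeredForest source target
  complete-at = record
    { tree     = completedTree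
    ; labels   = ↭.++⁺ (↭-trans (↭-reflexive (≡.sym leaves-j)) (↭.filter-↭ (Subset._⊆? S) labels))
                       (↭-reflexive (concat-singletons (singletonsOutside S)))
    ; layering = completedLayering
    }
    where
    leaves-j : filter (Subset._⊆? S) (concat (tabulate (leaves ∘ tree))) ≡ leaves (tree j)
    leaves-j = filter-concat (Subset._⊆? S) (leaves ∘ tree) j (leaves-⊆ (tree j)) λ i i≢j →
      All.zipWith (λ {B} ((B⊆Sᵢ , B≢∅) : (B ⊆ block P i) × Nonempty B) → ⊈-Disjoint B≢∅
                     (Disjoint-⊆ B (block P i) B⊆Sᵢ (AllPairs-lookup Disjoint-sym (disjoint P) i≢j)))
                  (leaves-⊆ (tree i) , leaves-nonempty (tree i))

open Completion public using (complete-at)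

record Cut (P Q : Partition n) : Set where
  field
    C D    : Subset n
    others : List (Subset n)
    source : blocks P ↭ (C ∪ D) ∷ others
    target : blocks Q ↭ C ∷ D ∷ others

opposite : {P Q : Partition n} → Cut P Q → Cut P Q
opposite {P = P} V = record
  { C = D ; D = C ; others = others
  ; source = subst (λ E → blocks P ↭ E ∷ others) (Subset.∪-comm C D) source
  ; target = ↭-trans target (swap C D ↭-refl)
  }
  where open Cut V

data Cuts {n : ℕ} (P Q : Partition n) : Set where
  done : P ≈ᴾ Q → Cuts P Q
  _⟫_  : {P′ : Partition n} → Cut P P′ → Cuts P′ Q → Cuts P Q

split : (P : Partition n) {C D : Subset n} {Bs : List (Subset n)} → blocks P ↭ (C ∪ D) ∷ Bs →
        Nonempty C → Nonempty D → Disjoint C D → Partition n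
split P {C} {D} {Bs} e C≢∅ D≢∅ C∩D≡∅ = record
  { blocks   = C ∷ D ∷ Bs
  ; nonempty = C≢∅ ∷ D≢∅ ∷ All.tail (↭.All-resp-↭ e (nonempty P))
  ; disjoint = case AllPairs-resp-↭ Disjoint-sym e (disjoint P) of λ where
      (d ∷ ds) → (C∩D≡∅ ∷ All.map (Disjoint-⊆ C (C ∪ D) (Subset.p⊆p∪q D)) d)
               ∷ All.map (Disjoint-⊆ D (C ∪ D) (Subset.q⊆p∪q C D)) d ∷ ds
  ; cover    = λ i → case ↭.Any-resp-↭ e (cover P i) of λ where
      (here i∈)  → [ here , (λ i∈D → there (here i∈D)) ]′ (Subset.x∈p∪q⁻ C D i∈)
      (there i∈) → there (there i∈)
  }

-- The blocks at the leaves of t when only the nodes satisfying e have been cut.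
frontier : {S : Subset n} (t : Tree S) → (Node t → Bool) → List (Subset n)
frontier {S = S} (stick _ _)  e = [ S ]
frontier {S = S} (node _ l r) e =
  if e root then frontier l (e ∘ left) ++ frontier r (e ∘ right) else [ S ]

frontier-none : {S : Subset n} (t : Tree S) {e : Node t → Bool} → (∀ x → e x ≡ false) → frontier t e ≡ [ S ]
frontier-none (stick _ _)  none = ≡.refl
frontier-none (node _ l r) none rewrite none root = ≡.refl

frontier-all : {S : Subset n} (t : Tree S) {e : Node t → Bool} → (∀ x → e x ≡ true) → frontier t e ≡ leaves t
frontier-all (stick _ _)  all = ≡.refl
frontier-all (node _ l r) all rewrite all root =
  cong₂ _++_ (frontier-all l (all ∘ left)) (frontier-all r (all ∘ right))

frontier-cong : {S : Subset n} (t : Tree S) {e e′ : Node t → Bool} → (∀ x → e x ≡ e′ x) →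
                frontier t e ≡ frontier t e′
frontier-cong (stick _ _)  e≗e′ = ≡.refl
frontier-cong {S = S} (node _ l r) {e′ = e′} e≗e′ rewrite e≗e′ root =
  cong (λ xs → if e′ root then xs else [ S ])
    (cong₂ _++_ (frontier-cong l (e≗e′ ∘ left)) (frontier-cong r (e≗e′ ∘ right)))

record Refines {a} {A : Set a} (cd c d : A) (xs ys : List A) : Set a where
  constructor refines
  field
    {before after} : List A
    coarse : xs ≡ before ++ cd ∷ after
    fine   : ys ≡ before ++ c ∷ d ∷ after

module _ {a} {A : Set a} {cd c d : A} where

  Refines-++ˡ : ∀ {xs ys} zs {zs′} → zs ≡ zs′ → Refines cd c d xs ys → Refines cd c d (zs ++ xs) (zs′ ++ ys)
  Refines-++ˡ zs ≡.refl (refines {us} ≡.refl ≡.refl) =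
    refines {before = zs ++ us} (≡.sym (List.++-assoc zs us _)) (≡.sym (List.++-assoc zs us _))

  Refines-++ʳ : ∀ {xs ys} zs {zs′} → zs ≡ zs′ → Refines cd c d xs ys → Refines cd c d (xs ++ zs) (ys ++ zs′)
  Refines-++ʳ zs ≡.refl (refines {us} ≡.refl ≡.refl) =
    refines {before = us} (List.++-assoc us _ zs) (List.++-assoc us _ zs)

  Refines-concat : (f g : Fin k → List A) (j : Fin k) → Refines cd c d (f j) (g j) →
                   (∀ i → i ≢ j → f i ≡ g i) →
                   Refines cd c d (concat (tabulate f)) (concat (tabulate g))
  Refines-concat f g zero    r same = Refines-++ʳ _
    (cong concat (List.tabulate-cong λ i → same (suc i) λ ())) r
  Refines-concat f g (suc j) r same = Refines-++ˡ (f zero) (same zero λ ())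
    (Refines-concat (f ∘ suc) (g ∘ suc) j r λ i i≢j → same (suc i) (i≢j ∘ Fin.suc-injective))

frontier-step : {S : Subset n} {t : Tree S} (x : Node t) {e e′ : Node t → Bool} →
                e x ≡ false → e′ x ≡ true → (∀ y → y ≢ x → e y ≡ e′ y) →
                (∀ {y} → y ◁ x → e y ≡ true) → (∀ {y} → x ◁ y → e y ≡ false) →
                Refines (leftOf x ∪ rightOf x) (leftOf x) (rightOf x) (frontier t e) (frontier t e′)
frontier-step {t = node _ l r} root {e} {e′} ex e′x same above below
  rewrite ex | e′x
        | frontier-none l {e′ ∘ left}  (λ y → ≡.trans (≡.sym (same (left y) λ ())) (below root◁left))
        | frontier-none r {e′ ∘ right} (λ y → ≡.trans (≡.sym (same (right y) λ ())) (below root◁right))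
  = refines {before = []} ≡.refl ≡.refl
frontier-step {t = node _ l r} (left x) {e} {e′} ex e′x same above below
  rewrite ≡.sym (same root λ ()) | above root◁left
  = Refines-++ʳ _ (frontier-cong r λ y → same (right y) λ ())
      (frontier-step x ex e′x (λ y y≢x → same (left y) λ { ≡.refl → y≢x ≡.refl })
        (above ∘ left◁left) (below ∘ left◁left))
frontier-step {t = node _ l r} (right x) {e} {e′} ex e′x same above below
  rewrite ≡.sym (same root λ ()) | above root◁right
  = Refines-++ˡ _ (frontier-cong l λ y → same (left y) λ ())
      (frontier-step x ex e′x (λ y y≢x → same (right y) λ { ≡.refl → y≢x ≡.refl })
        (above ∘ right◁right) (below ∘ right◁right))

split-nonempty : {S : Subset n} {t : Tree S} (x : Node t) → Nonempty (leftOf x) × Nonempty (rightOf x)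
split-nonempty {t = node _ l r} root      = tree-nonempty l , tree-nonempty r
split-nonempty {t = node _ l r} (left x)  = split-nonempty x
split-nonempty {t = node _ l r} (right x) = split-nonempty x

split-disjoint : {S : Subset n} {t : Tree S} (x : Node t) → Disjoint (leftOf x) (rightOf x)
split-disjoint {t = node d l r} root      = d
split-disjoint {t = node d l r} (left x)  = split-disjoint x
split-disjoint {t = node d l r} (right x) = split-disjoint x

module Decomposition {n} {P Q : Partition n} (F : LayeredForest P Q) where

  open LayeredForest F
  open Family tree
  open DecMembership _≟ᶠ_ using (_∈?_)

  isCut : List ForestNode → ForestNode → Bool
  isCut remaining x = not (does (x ∈? remaining))

  forestFrontier : List ForestNode → List (Subset n)
  forestFrontier remaining = concat (tabulate λ j → frontier (tree j) (λ x → isCut remaining (j , x)))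

  isCut-∈ : ∀ {x xs} → x ∈ˡ xs → isCut xs x ≡ false
  isCut-∈ {x} {xs} x∈ = cong not (dec-true (x ∈? xs) x∈)

  isCut-∉ : ∀ {x xs} → x ∉ˡ xs → isCut xs x ≡ true
  isCut-∉ {x} {xs} x∉ = cong not (dec-false (x ∈? xs) x∉)

  isCut-∷ : ∀ {x y xs} → y ≢ x → isCut (x ∷ xs) y ≡ isCut xs y
  isCut-∷ {x} {y} {xs} y≢x = case y ∈? xs of λ where
    (yes y∈) → ≡.trans (isCut-∈ {y} {x ∷ xs} (there y∈)) (≡.sym (isCut-∈ {y} {xs} y∈))
    (no  y∉) → ≡.trans (isCut-∉ {y} {x ∷ xs} λ { (here y≡x) → y≢x y≡x ; (there y∈) → y∉ y∈ })
                        (≡.sym (isCut-∉ {y} {xs} y∉))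

  ◁-irrefl : ∀ {S : Subset n} {t : Tree S} {x : Node t} → ¬ x ◁ x
  ◁-irrefl (left◁left p)   = ◁-irrefl p
  ◁-irrefl (right◁right p) = ◁-irrefl p

  node≢ : ∀ {j} {x y : Node (tree j)} → y ≢ x → _≢_ {A = ForestNode} (j , y) (j , x)
  node≢ y≢x ≡.refl = y≢x ≡.refl

  -- The cuts at the nodes in remaining, starting from the partition P′ reached by
  -- having cut all other nodes.
  cutAlong : (remaining : List ForestNode) → Unique remaining →
             AllPairs (λ x y → ¬ y ◁ᶠ x) remaining →
             (∀ {x y} → x ∈ˡ remaining → x ◁ᶠ y → y ∈ˡ remaining) →
             (P′ : Partition n) → blocks P′ ↭ forestFrontier remaining → Cuts P′ Q
  cutAlong [] _ _ _ P′ e = done (↭-trans e (↭-trans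
    (↭-reflexive (cong concat (List.tabulate-cong λ j → frontier-all (tree j) λ _ → ≡.refl))) labels))
  cutAlong ((j , x) ∷ xs) (x∉xs ∷ u) (p ∷ ps) closed P′ e =
    record { C = C ; D = D ; others = before ++ after ; source = e′ ; target = ↭-refl }
    ⟫ cutAlong xs u ps closed′ (split P′ e′ (proj₁ ne) (proj₂ ne) (split-disjoint x))
        (↭-sym (↭-trans (↭-reflexive fine) (↭-trans (↭.shift C before (D ∷ after))
                                                    (prep C (↭.shift D before after)))))
    where
    C D : Subset n
    C  = leftOf x
    D  = rightOf x
    ne = split-nonempty x

    x∉ : (j , x) ∉ˡ xs
    x∉ x∈ = All.lookup x∉xs x∈ ≡.refl

    step : Refines (C ∪ D) C D (forestFrontier ((j , x) ∷ xs)) (forestFrontier xs)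
    step = Refines-concat _ _ j
      (frontier-step x (isCut-∈ {j , x} {(j , x) ∷ xs} (here ≡.refl)) (isCut-∉ {j , x} {xs} x∉)
        (λ y y≢x → isCut-∷ {j , x} {j , y} {xs} (node≢ y≢x))
        (λ {y} y◁x → isCut-∉ {j , y} {(j , x) ∷ xs} λ where
          (here ≡.refl) → ◁-irrefl y◁x
          (there y∈)    → x∉ (case closed (there y∈) (within j y◁x) of λ where
            (here _)   → ⊥-elim (All.lookup p y∈ (within j y◁x))
            (there x∈) → x∈))
        (λ {y} x◁y → isCut-∈ {j , y} {(j , x) ∷ xs} (closed (here ≡.refl) (within j x◁y))))
      (λ i i≢j → frontier-cong (tree i) λ y → isCut-∷ {j , x} {i , y} {xs} λ { ≡.refl → i≢j ≡.refl })
    open Refines step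

    e′ : blocks P′ ↭ (C ∪ D) ∷ before ++ after
    e′ = ↭-trans e (↭-trans (↭-reflexive coarse) (↭.shift (C ∪ D) before after))

    closed′ : ∀ {y z} → y ∈ˡ xs → y ◁ᶠ z → z ∈ˡ xs
    closed′ y∈ y◁z = case closed (there y∈) y◁z of λ where
      (here ≡.refl) → ⊥-elim (All.lookup p y∈ y◁z)
      (there z∈)    → z∈

  decompose : Cuts P Q
  decompose = cutAlong order unique parents-first (λ {_} {y} _ _ → complete y) P
    (↭-sym (↭-reflexive (≡.trans
      (cong concat (List.tabulate-cong λ j → frontier-none (tree j) λ x → isCut-∈ {j , x} {order} (complete (j , x))))
      (concat-singletons (blocks P)))))

open Decomposition public using (decompose)

data Sign : Set where
  pos neg zer : Sign

-- The arrangement over an arbitrary ordered field R, in place of the reals, which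
-- are not available as a type; a real point h is the case R = ℝ.
module Arrangement {r₁ r₂ r₃} (R : OrderedField r₁ r₂ r₃) (n : ℕ) where

  open OrderedField R hiding (zero)
  open IsStrictTotalOrder isStrictTotalOrder
    using (compare; irrefl; <-respʳ-≈; <-respˡ-≈) renaming (trans to <-trans)
  open RingProperties ring
    using (-‿distribˡ-*; -‿distribʳ-*; -‿involutive; -0#≈0#; -‿+-comm)
  open Sum +-commutativeMonoid using (sum; sum-cong-≋; ∑-distrib-+; sum-replicate-zero)
  open SemiringSum semiring using (*-distribˡ-sum)

  Vector : Set r₁
  Vector = Fin n → Carrier

  total : Subset n → Vector → Carrier
  total S h = sum (λ i → if Vec.lookup S i then h i else 0#)

  T∨[_] : Partition n → Pred Vector r₂
  T∨[ P ] h = All (λ B → total B h ≈ 0#) (blocks P)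

  -- T∨[I], the case of the one-block partition.
  T∨I : Pred Vector r₂
  T∨I h = total Subset.⊤ h ≈ 0#

  data HasSign (x : Carrier) : Sign → Set (r₂ ⊔ r₃) where
    is-pos : 0# < x → HasSign x pos
    is-neg : x < 0# → HasSign x neg
    is-zer : x ≈ 0# → HasSign x zer

  Realizes : (Subset n → Sign) → Pred Vector (r₂ ⊔ r₃)
  Realizes s h = T∨I h × (∀ S → HasSign (total S h) (s S))

  data Span {a} (A : Pred Vector a) : Pred Vector (r₁ ⊔ r₂ ⊔ a) where
    null : ∀ {v} → (∀ i → v i ≈ 0#) → Span A v
    add  : ∀ a {x w v} → A x → Span A w → (∀ i → v i ≈ a * x i + w i) → Span A v

  -- The sign function is extended to all subsets of I; Realizes forces the
  -- values at ∅ and I to be zero.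
  record AdjointFace : Set (r₁ ⊔ r₂ ⊔ r₃) where
    field
      sign  : Subset n → Sign
      point : ∃ (Realizes sign)

  open AdjointFace public

  support : AdjointFace → Pred Vector (r₁ ⊔ r₂ ⊔ r₃)
  support X = Span (Realizes (sign X))

  record Face (P : Partition n) : Set (r₁ ⊔ r₂ ⊔ r₃) where
    field
      adjointFace : AdjointFace
      hasSupport  : support adjointFace ≐ T∨[ P ]
    open AdjointFace adjointFace public

  faceSetoid : Partition n → Setoid (r₁ ⊔ r₂ ⊔ r₃) 0ℓ
  faceSetoid P = record
    { Carrier       = Face P
    ; _≈_           = λ X Y → ∀ S → Face.sign X S ≡ Face.sign Y S
    ; isEquivalence = record
      { refl  = λ _ → ≡.refl
      ; sym   = λ e S → ≡.sym (e S)
      ; trans = λ e e′ S → ≡.trans (e S) (e′ S)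
      }
    }

  recast : {P Q : Partition n} → P ≈ᴾ Q → Face P → Face Q
  recast e X = record
    { adjointFace = Face.adjointFace X
    ; hasSupport  = ↭.All-resp-↭ e ∘ proj₁ (Face.hasSupport X)
                  , proj₂ (Face.hasSupport X) ∘ ↭.All-resp-↭ (↭-sym e)
    }

  private

    module ≈-Reasoning = SetoidReasoning setoid

    <-respˡ : ∀ {x y z} → x ≈ y → x < z → y < z
    <-respˡ = <-respˡ-≈

    <-respʳ : ∀ {x y z} → x ≈ y → z < x → z < y
    <-respʳ = <-respʳ-≈

    neg-pos : ∀ {x} → x < 0# → 0# < - x
    neg-pos {x} x<0 = <-respˡ (-‿inverseʳ x) (<-respʳ (+-identityˡ (- x)) (+-monoˡ-< (- x) x<0))

    0<1 : 0# < 1#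
    0<1 with compare 0# 1#
    ... | tri< 0<1 _ _   = 0<1
    ... | tri≈ _ 0≈1 _   = contradiction (sym 0≈1) 1≉0
    ... | tri> 0≮1 _ 1<0 = contradiction (<-respʳ minus-one² (*-pos (neg-pos 1<0) (neg-pos 1<0))) 0≮1
      where
      open ≈-Reasoning
      minus-one² : - 1# * - 1# ≈ 1#
      minus-one² = begin
        - 1# * - 1#     ≈⟨ -‿distribˡ-* 1# (- 1#) ⟨
        - (1# * - 1#)   ≈⟨ -‿cong (*-identityˡ (- 1#)) ⟩
        - (- 1#)        ≈⟨ -‿involutive 1# ⟩
        1#              ∎

    -1<0 : - 1# < 0#
    -1<0 = <-respˡ (+-identityˡ (- 1#)) (<-respʳ (-‿inverseʳ 1#) (+-monoˡ-< (- 1#) 0<1))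

    x<x+1 : ∀ x → x < x + 1#
    x<x+1 x = <-respˡ (+-identityˡ x) (<-respʳ (+-comm 1# x) (+-monoˡ-< x 0<1))

    sub-add : ∀ x y → (x + - y) + y ≈ x
    sub-add x y = trans (+-assoc x (- y) y) (trans (+-congˡ (-‿inverseˡ y)) (+-identityʳ x))

    *-monoˡ : ∀ {x y z} → 0# < z → x < y → x * z < y * z
    *-monoˡ {x} {y} {z} 0<z x<y =
      <-respˡ (+-identityˡ (x * z)) (<-respʳ e (+-monoˡ-< (x * z) (*-pos 0<y-x 0<z)))
      where
      0<y-x : 0# < y + - x
      0<y-x = <-respˡ (-‿inverseʳ x) (+-monoˡ-< (- x) x<y)
      e : (y + - x) * z + x * z ≈ y * z
      e = trans (sym (distribʳ z (y + - x) x)) (*-congʳ (sub-add y x))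

    bound : ∀ a b → ∃ λ m → ∀ {t} → m < t → (a < t) × (b < t)
    bound a b with compare a b
    ... | tri< a<b _ _ = b , λ b<t → <-trans a<b b<t , b<t
    ... | tri≈ _ a≈b _ = b , λ b<t → <-respˡ (sym a≈b) b<t , b<t
    ... | tri> _ _ b<a = a , λ a<t → a<t , <-trans b<a a<t

    Eventually : ∀ {p} → Pred Carrier p → Set (r₁ ⊔ r₃ ⊔ p)
    Eventually Φ = ∃ λ t₀ → ∀ t → t₀ < t → Φ t

    uniformly : ∀ {m p} {Φ : Subset m → Pred Carrier p} →
                (∀ S → Eventually (Φ S)) → Eventually (λ t → ∀ S → Φ S t)
    uniformly {zero}  {Φ = Φ} f = proj₁ (f []) , λ { t lt [] → proj₂ (f []) t lt }
    uniformly {suc m} {Φ = Φ} f =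
      let a , fa = uniformly {Φ = Φ ∘ (true ∷_)}  (f ∘ (true ∷_))
          b , fb = uniformly {Φ = Φ ∘ (false ∷_)} (f ∘ (false ∷_))
          t₀ , above = bound a b
      in t₀ , λ { t lt (true ∷ S)  → fa t (proj₁ (above lt)) S
                ; t lt (false ∷ S) → fb t (proj₂ (above lt)) S }

    HasSign-≈ : ∀ {s x y} → x ≈ y → HasSign x s → HasSign y s
    HasSign-≈ e (is-pos p) = is-pos (<-respʳ e p)
    HasSign-≈ e (is-neg p) = is-neg (<-respˡ e p)
    HasSign-≈ e (is-zer p) = is-zer (trans (sym e) p)

    zero-sign : ∀ {s x} → x ≈ 0# → HasSign x s → s ≡ zer
    zero-sign e (is-pos p) = ⊥-elim (irrefl (sym e) p)
    zero-sign e (is-neg p) = ⊥-elim (irrefl e p)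
    zero-sign e (is-zer p) = ≡.refl

    sign-zero : ∀ {s x} → s ≡ zer → HasSign x s → x ≈ 0#
    sign-zero ≡.refl (is-zer p) = p

    eventually-sign : ∀ {s x} y → s ≢ zer → HasSign x s → Eventually (λ t → HasSign (t * x + y) s)
    eventually-sign {x = x} y s≢0 hs = t₀ , λ t t₀<t → result t t₀<t hs
      where
      open ≈-Reasoning
      x≉0 : ¬ x ≈ 0#
      x≉0 x≈0 = s≢0 (zero-sign x≈0 hs)
      x⁻¹ t₀ : Carrier
      x⁻¹ = proj₁ (inverse x x≉0)
      t₀  = - y * x⁻¹
      e : t₀ * x + y ≈ 0#
      e = begin
        - y * x⁻¹ * x + y     ≈⟨ +-congʳ (*-assoc (- y) x⁻¹ x) ⟩
        - y * (x⁻¹ * x) + y   ≈⟨ +-congʳ (*-congˡ (trans (*-comm x⁻¹ x) (proj₂ (inverse x x≉0)))) ⟩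
        - y * 1# + y          ≈⟨ +-congʳ (*-identityʳ (- y)) ⟩
        - y + y               ≈⟨ -‿inverseˡ y ⟩
        0#                    ∎
      neg-* : ∀ t → t * - x ≈ - (t * x)
      neg-* t = sym (-‿distribʳ-* t x)
      neg-mono : ∀ {a b} → - a < - b → b < a
      neg-mono {a} {b} lt = <-respˡ (cancelˡ a b) (<-respʳ (cancel b a) (+-monoˡ-< (a + b) lt))
        where
        cancel : ∀ b a → - b + (a + b) ≈ a
        cancel b a = trans (+-comm _ _) (trans (+-assoc a b (- b)) (trans (+-congˡ (-‿inverseʳ b)) (+-identityʳ a)))
        cancelˡ : ∀ a b → - a + (a + b) ≈ b
        cancelˡ a b = trans (sym (+-assoc (- a) a b)) (trans (+-congʳ (-‿inverseˡ a)) (+-identityˡ b))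
      result : ∀ {s} t → t₀ < t → HasSign x s → HasSign (t * x + y) s
      result t lt (is-pos 0<x) = is-pos (<-respˡ e (+-monoˡ-< y (*-monoˡ 0<x lt)))
      result t lt (is-neg x<0) = is-neg (<-respʳ e (+-monoˡ-< y (neg-mono
        (<-respˡ (neg-* t₀) (<-respʳ (neg-* t) (*-monoˡ (neg-pos x<0) lt))))))
      result t lt (is-zer x≈0) = ⊥-elim (x≉0 x≈0)

    at : Subset n → Vector → Vector
    at S h i = if Vec.lookup S i then h i else 0#

    at-∈ : ∀ {S} h {i} → i ∈ S → at S h i ≡ h i
    at-∈ h i∈S rewrite Vec.[]=⇒lookup i∈S = ≡.refl

    at-∉ : ∀ {S} h {i} → i ∉ S → at S h i ≡ 0#
    at-∉ {S} h {i} i∉S with Vec.lookup S i in e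
    ... | true  = ⊥-elim (i∉S (Vec.lookup⇒[]= i S e))
    ... | false = ≡.refl

    total-cong : ∀ S {h h′} → (∀ i → h i ≈ h′ i) → total S h ≈ total S h′
    total-cong S {h} {h′} e = sum-cong-≋ λ i → at-cong i
      where
      at-cong : ∀ i → at S h i ≈ at S h′ i
      at-cong i with Vec.lookup S i
      ... | true  = e i
      ... | false = refl

    total-linear : ∀ S a h h′ → total S (λ i → a * h i + h′ i) ≈ a * total S h + total S h′
    total-linear S a h h′ = begin
      sum (at S (λ i → a * h i + h′ i))            ≈⟨ sum-cong-≋ pointwise ⟩
      sum (λ i → a * at S h i + at S h′ i)         ≈⟨ ∑-distrib-+ (λ i → a * at S h i) (at S h′) ⟩
      sum (λ i → a * at S h i) + sum (at S h′)     ≈⟨ +-congʳ (*-distribˡ-sum a (at S h)) ⟨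
      a * sum (at S h) + sum (at S h′)             ∎
      where
      open ≈-Reasoning
      pointwise : ∀ i → at S (λ i → a * h i + h′ i) i ≈ a * at S h i + at S h′ i
      pointwise i with Vec.lookup S i
      ... | true  = refl
      ... | false = sym (trans (+-identityʳ _) (zeroʳ a))

    sum-zero : ∀ {m} (f : Fin m → Carrier) → (∀ i → f i ≈ 0#) → sum f ≈ 0#
    sum-zero {m} f e = trans (sum-cong-≋ e) (sum-replicate-zero m)

    total-zero : ∀ S h → (∀ {i} → i ∈ S → h i ≈ 0#) → total S h ≈ 0#
    total-zero S h e = sum-zero (at S h) pointwise
      where
      pointwise : ∀ i → at S h i ≈ 0#
      pointwise i with Vec.lookup S i in eq
      ... | true  = e (Vec.lookup⇒[]= i S eq)
      ... | false = refl

    total-empty : ∀ S h → Empty S → total S h ≈ 0#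
    total-empty S h S≡∅ = total-zero S h λ i∈S → ⊥-elim (S≡∅ (_ , i∈S))

    total-∪ : ∀ A B h → Disjoint A B → total (A ∪ B) h ≈ total A h + total B h
    total-∪ A B h d = trans (sum-cong-≋ pointwise) (∑-distrib-+ (at A h) (at B h))
      where
      pointwise : ∀ i → at (A ∪ B) h i ≈ at A h i + at B h i
      pointwise i with i Subset.∈? A | i Subset.∈? B
      ... | yes i∈A | yes i∈B = ⊥-elim (∉-Disjoint d i∈A i∈B)
      ... | yes i∈A | no  i∉B = sym (trans (+-cong (reflexive (at-∈ h i∈A)) (reflexive (at-∉ h i∉B)))
              (trans (+-identityʳ _) (reflexive (≡.sym (at-∈ {A ∪ B} h (Subset.x∈p∪q⁺ (inj₁ i∈A)))))))
      ... | no  i∉A | yes i∈B = sym (trans (+-cong (reflexive (at-∉ h i∉A)) (reflexive (at-∈ h i∈B)))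
              (trans (+-identityˡ _) (reflexive (≡.sym (at-∈ {A ∪ B} h (Subset.x∈p∪q⁺ {p = A} (inj₂ i∈B)))))))
      ... | no  i∉A | no  i∉B = trans (reflexive (at-∉ h ([ i∉A , i∉B ]′ ∘ Subset.x∈p∪q⁻ A B)))
              (sym (trans (+-cong (reflexive (at-∉ h i∉A)) (reflexive (at-∉ h i∉B))) (+-identityˡ _)))

    total-at : ∀ E S h → total E (at S h) ≈ total (E ∩ S) h
    total-at E S h = sum-cong-≋ pointwise
      where
      pointwise : ∀ i → at E (at S h) i ≈ at (E ∩ S) h i
      pointwise i rewrite Vec.lookup-zipWith _∧_ i E S with Vec.lookup E i | Vec.lookup S i
      ... | true  | _ = refl
      ... | false | _ = refl

    total-≡ : ∀ {A B} h → A ≡ B → total A h ≈ total B h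
    total-≡ h ≡.refl = refl

    ⊆⇒∪─ : ∀ {A B : Subset n} → A ⊆ B → B ≡ A ∪ (B ─ A)
    ⊆⇒∪─ {A} {B} A⊆B = Subset.⊆-antisym
      (λ {i} i∈B → Subset.x∈p∪q⁺ (case i Subset.∈? A of λ where
        (yes i∈A) → inj₁ i∈A
        (no  i∉A) → inj₂ (Subset.x∈p∧x∉q⇒x∈p─q i∈B i∉A)))
      (λ i∈ → [ A⊆B , Subset.p─q⊆p B A ]′ (Subset.x∈p∪q⁻ A (B ─ A) i∈))

    ─-Disjoint : ∀ {A B : Subset n} → Disjoint A (B ─ A)
    ─-Disjoint {A} {B} (i , i∈) =
      let i∈A , i∈B─A = Subset.x∈p∩q⁻ A (B ─ A) i∈ in ∈─⁻ B A i∈B─A i∈A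

    saturated-total : (Q : Partition n) {S : Subset n} {h : Vector} →
                      T∨[ Q ] h → Saturated Q S → total S h ≈ 0#
    saturated-total Q {S} {h} = go (blocks Q) S (disjoint Q) (λ {i} _ → cover Q i)
      where
      go : ∀ Bs S → AllPairs Disjoint Bs → (∀ {i} → i ∈ S → Any (i ∈_) Bs) →
           All (λ B → total B h ≈ 0#) Bs → All (λ B → B ⊆ S ⊎ Disjoint B S) Bs → total S h ≈ 0#
      go [] S _ cov _ _ = total-empty S h λ (i , i∈S) → case cov i∈S of λ ()
      go (B ∷ Bs) S (d ∷ ds) cov (z ∷ zs) (inj₁ B⊆S ∷ sat) = begin
        total S h                       ≈⟨ total-≡ h (⊆⇒∪─ B⊆S) ⟩
        total (B ∪ (S ─ B)) h           ≈⟨ total-∪ B (S ─ B) h ─-Disjoint ⟩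
        total B h + total (S ─ B) h     ≈⟨ +-cong z (go Bs (S ─ B) ds cov′ zs sat′) ⟩
        0# + 0#                         ≈⟨ +-identityˡ 0# ⟩
        0#                              ∎
        where
        open ≈-Reasoning
        cov′ : ∀ {i} → i ∈ S ─ B → Any (i ∈_) Bs
        cov′ i∈ with cov (Subset.p─q⊆p S B i∈)
        ... | here i∈B  = ⊥-elim (∈─⁻ S B i∈ i∈B)
        ... | there any = any
        inside : ∀ {E} → Disjoint B E × (E ⊆ S ⊎ Disjoint E S) → E ⊆ S ─ B ⊎ Disjoint E (S ─ B)
        inside (B∩E≡∅ , inj₁ E⊆S) = inj₁ λ i∈E →
          Subset.x∈p∧x∉q⇒x∈p─q (E⊆S i∈E) (λ i∈B → ∉-Disjoint B∩E≡∅ i∈B i∈E)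
        inside {E} (_ , inj₂ d) = inj₂ (Disjoint-sym (Disjoint-⊆ (S ─ B) S (Subset.p─q⊆p S B) (Disjoint-sym d)))
        sat′ = All.zipWith inside (d , sat)
      go (B ∷ Bs) S (d ∷ ds) cov (z ∷ zs) (inj₂ B∩S≡∅ ∷ sat) = go Bs S ds cov′ zs sat
        where
        cov′ : ∀ {i} → i ∈ S → Any (i ∈_) Bs
        cov′ i∈S with cov i∈S
        ... | here i∈B  = ⊥-elim (∉-Disjoint B∩S≡∅ i∈B i∈S)
        ... | there any = any

    δ : ∀ {m} → Fin m → Fin m → Carrier
    δ zero    zero    = 1#
    δ zero    (suc j) = 0#
    δ (suc i) zero    = 0#
    δ (suc i) (suc j) = δ i j

    sum-δ : ∀ {m} (i : Fin m) → sum (δ i) ≈ 1#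
    sum-δ {suc m} zero = trans (+-congˡ (sum-zero {m} (λ _ → 0#) λ _ → refl)) (+-identityʳ 1#)
    sum-δ (suc i)      = trans (+-identityˡ (sum (δ i))) (sum-δ i)

    total-δ : ∀ S c → total S (δ c) ≈ (if Vec.lookup S c then 1# else 0#)
    total-δ S c = go S c
      where
      if-0 : ∀ b → (if b then 0# else 0#) ≈ 0#
      if-0 true  = refl
      if-0 false = refl
      go : ∀ {m} (S : Subset m) c → sum (λ i → if Vec.lookup S i then δ c i else 0#) ≈ (if Vec.lookup S c then 1# else 0#)
      go (b ∷ S) zero    = trans (+-congˡ (sum-zero _ λ i → if-0 (Vec.lookup S i))) (+-identityʳ _)
      go (b ∷ S) (suc c) = trans (+-cong (if-0 b) (go S c)) (+-identityˡ _)

    total-δ-∈ : ∀ {S c} → c ∈ S → total S (δ c) ≈ 1#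
    total-δ-∈ {S} {c} c∈S = trans (total-δ S c) (reflexive (cong (if_then 1# else 0#) (Vec.[]=⇒lookup c∈S)))

    total-δ-∉ : ∀ {S c} → c ∉ S → total S (δ c) ≈ 0#
    total-δ-∉ {S} {c} c∉S = trans (total-δ S c) (reflexive (at-∉ {S} (λ _ → 1#) c∉S))

    transfer : Fin n → Fin n → Vector
    transfer c d i = - 1# * δ d i + δ c i

    module _ {c d : Fin n} {S : Subset n} where
      private
        u = total S (transfer c d)
        open ≈-Reasoning

        u-eq : ∀ {x y} → total S (δ c) ≈ x → total S (δ d) ≈ y → u ≈ x + - y
        u-eq {x} {y} ex ey = begin
          u                                         ≈⟨ total-linear S (- 1#) (δ d) (δ c) ⟩
          - 1# * total S (δ d) + total S (δ c)      ≈⟨ +-cong (*-congˡ ey) ex ⟩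
          - 1# * y + x                              ≈⟨ +-congʳ (-‿distribˡ-* 1# y) ⟨
          - (1# * y) + x                            ≈⟨ +-congʳ (-‿cong (*-identityˡ y)) ⟩
          - y + x                                   ≈⟨ +-comm _ _ ⟩
          x + - y                                   ∎

      transfer-in : c ∈ S → d ∉ S → u ≈ 1#
      transfer-in c∈ d∉ = trans (u-eq (total-δ-∈ c∈) (total-δ-∉ d∉)) (trans (+-congˡ -0#≈0#) (+-identityʳ 1#))

      transfer-out : c ∉ S → d ∈ S → u ≈ - 1#
      transfer-out c∉ d∈ = trans (u-eq (total-δ-∉ c∉) (total-δ-∈ d∈)) (+-identityˡ _)

      transfer-both : c ∈ S → d ∈ S → u ≈ 0#
      transfer-both c∈ d∈ = trans (u-eq (total-δ-∈ c∈) (total-δ-∈ d∈)) (-‿inverseʳ 1#)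

      transfer-neither : c ∉ S → d ∉ S → u ≈ 0#
      transfer-neither c∉ d∉ = trans (u-eq (total-δ-∉ c∉) (total-δ-∉ d∉)) (-‿inverseʳ 0#)

    module _ {a} {A : Pred Vector a} where

      Span-gen : ∀ {v} → A v → Span A v
      Span-gen {v} Av = add 1# Av (null {v = λ _ → 0#} λ _ → refl) λ i →
        sym (trans (+-identityʳ _) (*-identityˡ (v i)))

      Span-linear : ∀ b {v w x} → Span A v → Span A w → (∀ i → x i ≈ b * v i + w i) → Span A x
      Span-linear b (null e) (null e′) e″ =
        null λ i → trans (e″ i) (trans (+-cong (trans (*-congˡ (e i)) (zeroʳ b)) (e′ i)) (+-identityˡ 0#))
      Span-linear b {v} {w} (null e) (add a Ay sz e′) e″ = add a Ay sz λ i →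
        trans (e″ i) (trans (+-cong (trans (*-congˡ (e i)) (zeroʳ b)) (e′ i)) (+-identityˡ _))
      Span-linear b {v} {w} {x} (add a {y} {z} Ay sz e) sw e″ =
        add (b * a) Ay (Span-linear b sz sw λ _ → refl) λ i → begin
          x i                                ≈⟨ e″ i ⟩
          b * v i + w i                      ≈⟨ +-congʳ (*-congˡ (e i)) ⟩
          b * (a * y i + z i) + w i          ≈⟨ +-congʳ (distribˡ b _ _) ⟩
          (b * (a * y i) + b * z i) + w i    ≈⟨ +-assoc _ _ _ ⟩
          b * (a * y i) + (b * z i + w i)    ≈⟨ +-congʳ (*-assoc b a (y i)) ⟨
          b * a * y i + (b * z i + w i)      ∎
        where open ≈-Reasoning

      Span-total : ∀ {S v} → (∀ {x} → A x → total S x ≈ 0#) → Span A v → total S v ≈ 0#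
      Span-total {S} {v} A0 (null e) = total-zero S v λ {i} _ → e i
      Span-total {S} {v} A0 (add a {x} {w} Ax sw e) = begin
        total S v                       ≈⟨ total-cong S e ⟩
        total S (λ i → a * x i + w i)   ≈⟨ total-linear S a x w ⟩
        a * total S x + total S w       ≈⟨ +-cong (trans (*-congˡ (A0 Ax)) (zeroʳ a)) (Span-total {S} A0 sw) ⟩
        0# + 0#                         ≈⟨ +-identityˡ 0# ⟩
        0#                              ∎
        where open ≈-Reasoning

    module _ {a} {A : Pred Vector a} {b} {B : Pred Vector b} where

      Span-bind : ∀ {v} → (∀ {x} → A x → Span B x) → Span A v → Span B v
      Span-bind A⊆B (null e)        = null e
      Span-bind A⊆B (add a Ax sw e) = Span-linear a (A⊆B Ax) (Span-bind A⊆B sw) e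

      Span-at : ∀ S {v} → (∀ {x} → A x → B (at S x)) → Span A v → Span B (at S v)
      Span-at S {v} A⊆B (null e) = null pointwise
        where
        pointwise : ∀ i → at S v i ≈ 0#
        pointwise i with Vec.lookup S i
        ... | true  = e i
        ... | false = refl
      Span-at S {v} A⊆B (add a {x} {w} Ax sw e) = add a (A⊆B Ax) (Span-at S A⊆B sw) pointwise
        where
        pointwise : ∀ i → at S v i ≈ a * at S x i + at S w i
        pointwise i with Vec.lookup S i
        ... | true  = e i
        ... | false = sym (trans (+-identityʳ _) (zeroʳ a))

    Span-≈ : ∀ {a} {A : Pred Vector a} {v w} → (∀ i → v i ≈ w i) → Span A w → Span A v
    Span-≈ e (null e′)         = null λ i → trans (e i) (e′ i)
    Span-≈ e (add a Ax sw e′) = add a Ax sw λ i → trans (e i) (e′ i)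

  module _ {Q : Partition n} (X : Face Q) where

    private
      module X = Face X

    realizes⇒T∨ : ∀ {h} → Realizes X.sign h → T∨[ Q ] h
    realizes⇒T∨ r = proj₁ X.hasSupport (Span-gen r)

    saturated⇒zer : ∀ {S} → Saturated Q S → X.sign S ≡ zer
    saturated⇒zer {S} sat = zero-sign
      (saturated-total Q (realizes⇒T∨ (proj₂ X.point)) sat) (proj₂ (proj₂ X.point) S)

    -- X|ₛ.  When E ∩ S = ∅ the sign is that of ∅, which is zero.
    module Restriction {S : Subset n} (sat : Saturated Q S) where

      restrictedSign : Subset n → Sign
      restrictedSign E = X.sign (E ∩ S)

      private
        realizes : ∀ {h} → Realizes X.sign h → Realizes restrictedSign (at S h)
        realizes {h} r =
          trans (total-at Subset.⊤ S h)
            (trans (total-≡ h (Subset.∩-identityˡ S)) (saturated-total Q (realizes⇒T∨ r) sat)) ,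
          λ E → HasSign-≈ (sym (total-at E S h)) (proj₂ r (E ∩ S))

        sign-block : ∀ {B} → B ∈ˡ blocks (Q ↾ S by sat) → restrictedSign B ≡ zer
        sign-block {B} B∈ with ∈ˡ.∈-++⁻ (filter (Subset._⊆? S) (blocks Q)) B∈
        ... | inj₁ B∈f =
          let B∈Q , B⊆S = ∈ˡ.∈-filter⁻ (Subset._⊆? S) {xs = blocks Q} B∈f
          in zero-sign
               (trans (total-≡ _ (Subset.⊆-antisym (Subset.p∩q⊆p B S) (λ i∈B → Subset.x∈p∩q⁺ (i∈B , B⊆S i∈B))))
                      (All.lookup (realizes⇒T∨ (proj₂ X.point)) B∈Q))
               (proj₂ (proj₂ X.point) (B ∩ S))
        ... | inj₂ B∈s = zero-sign
          (total-empty (B ∩ S) _ (Disjoint-sym (All.lookup (singletons-outside S) B∈s)))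
          (proj₂ (proj₂ X.point) (B ∩ S))

        ⊆T∨ : ∀ {v} → Span (Realizes restrictedSign) v → T∨[ Q ↾ S by sat ] v
        ⊆T∨ sv = All.tabulate λ {B} B∈ →
          Span-total {S = B} (λ r → sign-zero (sign-block B∈) (proj₂ r B)) sv

        module _ {v : Vector} (v∈T : T∨[ Q ↾ S by sat ] v) where

          outside-zero : ∀ {i} → i ∉ S → v i ≈ 0#
          outside-zero {i} i∉S =
            trans (sym (+-identityʳ (v i)))
              (trans (sym singleton-sum)
                (All.lookup v∈T (∈ˡ.∈-++⁺ʳ _ (∈ˡ.∈-map⁺ ⁅_⁆ (∈ˡ.∈-filter⁺ _ (∈ˡ.∈-allFin i) i∉S)))))
            where
            open ≈-Reasoning
            pointwise : ∀ j → at ⁅ i ⁆ v j ≈ v i * δ i j + 0#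
            pointwise j with j Subset.∈? ⁅ i ⁆
            ... | yes j∈ with Subset.x∈⁅y⁆⇒x≡y i j∈
            ...   | ≡.refl = trans (reflexive (at-∈ {⁅ i ⁆} v j∈)) (sym (trans (+-identityʳ _)
                      (trans (*-congˡ (δ-diag i)) (*-identityʳ (v i)))))
              where
              δ-diag : ∀ {m} (i : Fin m) → δ i i ≈ 1#
              δ-diag zero    = refl
              δ-diag (suc i) = δ-diag i
            pointwise j | no j∉ = trans (reflexive (at-∉ {⁅ i ⁆} v j∉)) (sym (trans (+-identityʳ _)
                      (trans (*-congˡ (δ-off i j (λ { ≡.refl → j∉ (Subset.x∈⁅x⁆ i) }))) (zeroʳ (v i)))))
              where
              δ-off : ∀ {m} (i j : Fin m) → i ≢ j → δ i j ≈ 0#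
              δ-off zero    zero    i≢j = contradiction ≡.refl i≢j
              δ-off zero    (suc j) i≢j = refl
              δ-off (suc i) zero    i≢j = refl
              δ-off (suc i) (suc j) i≢j = δ-off i j (i≢j ∘ cong suc)
            singleton-sum : total ⁅ i ⁆ v ≈ v i + 0#
            singleton-sum = begin
              sum (at ⁅ i ⁆ v)                  ≈⟨ sum-cong-≋ pointwise ⟩
              sum (λ j → v i * δ i j + 0#)      ≈⟨ sum-cong-≋ (λ j → +-identityʳ (v i * δ i j)) ⟩
              sum (λ j → v i * δ i j)           ≈⟨ *-distribˡ-sum (v i) (δ i) ⟨
              v i * sum (δ i)                   ≈⟨ *-congˡ (sum-δ i) ⟩
              v i * 1#                          ≈⟨ *-identityʳ (v i) ⟩
              v i                               ≈⟨ +-identityʳ (v i) ⟨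
              v i + 0#                          ∎

          v∈TQ : T∨[ Q ] v
          v∈TQ = All.tabulate λ {B} B∈ → case All.lookup sat B∈ of λ where
            (inj₁ B⊆S) → All.lookup v∈T (∈ˡ.∈-++⁺ˡ (∈ˡ.∈-filter⁺ (Subset._⊆? S) B∈ B⊆S))
            (inj₂ d)   → total-zero B v λ i∈B → outside-zero (∉-Disjoint d i∈B)

          T∨⊆ : Span (Realizes restrictedSign) v
          T∨⊆ = Span-≈ pointwise (Span-at S realizes (proj₂ X.hasSupport v∈TQ))
            where
            pointwise : ∀ i → v i ≈ at S v i
            pointwise i with i Subset.∈? S
            ... | yes i∈S = reflexive (≡.sym (at-∈ v i∈S))
            ... | no  i∉S = trans (outside-zero i∉S) (reflexive (≡.sym (at-∉ v i∉S)))

      restriction : Face (Q ↾ S by sat)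
      restriction = record
        { adjointFace = record
          { sign  = restrictedSign
          ; point = at S (proj₁ X.point) , realizes (proj₂ X.point)
          }
        ; hasSupport = ⊆T∨ , T∨⊆
        }

  open Restriction public using (restriction)

  Redn-⊥ : (P : Partition n) → Redn P Subset.⊥ ≡ Subset.⊥
  Redn-⊥ P = Subset.Empty-unique λ (i , i∈) → Subset.∉⊥ (∈-Redn⇒∈ P i∈)

  inside-or-disjoint : ∀ (B S : Subset n) → (∀ {i} → i ∈ B → i ∈ S → ¬ (B ⊈ S)) → B ⊆ S ⊎ Disjoint B S
  inside-or-disjoint B S f with Subset.nonempty? (B ∩ S) | B Subset.⊆? S
  ... | no d         | _       = inj₂ d
  ... | yes _        | yes B⊆S = inj₁ B⊆S
  ... | yes (i , i∈) | no B⊈S  =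
    let i∈B , i∈S = Subset.x∈p∩q⁻ B S i∈ in ⊥-elim (f i∈B i∈S B⊈S)

  null⇒saturated : (Q : Partition n) {S : Subset n} → S ≡ Subset.⊥ mod Q → Saturated Q S
  null⇒saturated Q {S} S≡∅ = All.tabulate λ {B} B∈ → inside-or-disjoint B S λ i∈B i∈S B⊈S →
    Subset.∉⊥ (subst (_ ∈_) (≡.trans S≡∅ (Redn-⊥ Q)) (∈-Redn⁺ Q i∈S B∈ i∈B B⊈S))

  not-null⇒≢zer : {Q : Partition n} (X : Face Q) {S : Subset n} → ¬ S ≡ Subset.⊥ mod Q → Face.sign X S ≢ zer
  not-null⇒≢zer {Q} X {S} S≢∅ s≡0 = S≢∅ (≡.trans (Subset.Empty-unique empty) (≡.sym (Redn-⊥ Q)))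
    where
    empty : Empty (Redn Q S)
    empty (b , b∈R) =
      let B , B∈ , b∈B = blockOf Q b
          b∈S          = ∈-Redn⇒∈ Q b∈R
      in case Subset.nonempty? (B ─ S) of λ where
        (no B─S≡∅) → ∈-Redn⇒⊈ Q b∈R B∈ b∈B (λ {i} i∈B → case i Subset.∈? S of λ where
          (yes i∈S) → i∈S
          (no  i∉S) → ⊥-elim (B─S≡∅ (i , Subset.x∈p∧x∉q⇒x∈p─q i∈B i∉S)))
        (yes (b′ , b′∈)) →
          let b′∈B = Subset.p─q⊆p B S b′∈
              b′∉S = ∈─⁻ B S b′∈
              v∈T  : T∨[ Q ] (transfer b b′)
              v∈T  = All.tabulate λ {B′} B′∈ → case b Subset.∈? B′ of λ where
                (yes b∈B′) → transfer-both b∈B′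
                  (subst (b′ ∈_) (∈-unique (disjoint Q) B∈ B′∈ b∈B b∈B′) b′∈B)
                (no  b∉B′) → transfer-neither b∉B′ λ b′∈B′ →
                  b∉B′ (subst (b ∈_) (∈-unique (disjoint Q) B∈ B′∈ b′∈B b′∈B′) b∈B)
          in 1≉0 (trans (sym (transfer-in b∈S b′∉S))
               (Span-total {S = S} (λ r → sign-zero s≡0 (proj₂ r S)) (proj₂ (Face.hasSupport X) v∈T)))

  module CutProperties {P Q : Partition n} (V : Cut P Q) where
    open Cut V public

    parent∈ : (C ∪ D) ∈ˡ blocks P
    parent∈ = ↭.∈-resp-↭ (↭-sym source) (here ≡.refl)

    C∈ : C ∈ˡ blocks Q
    C∈ = ↭.∈-resp-↭ (↭-sym target) (here ≡.refl)

    D∈ : D ∈ˡ blocks Q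
    D∈ = ↭.∈-resp-↭ (↭-sym target) (there (here ≡.refl))

    others∈ : ∀ {B} → B ∈ˡ others → B ∈ˡ blocks P
    others∈ B∈ = ↭.∈-resp-↭ (↭-sym source) (there B∈)

    C≢∅ : Nonempty C
    C≢∅ = All.lookup (nonempty Q) C∈

    D≢∅ : Nonempty D
    D≢∅ = All.lookup (nonempty Q) D∈

    private
      pairs : AllPairs Disjoint (C ∷ D ∷ others)
      pairs = AllPairs-resp-↭ Disjoint-sym target (disjoint Q)

    C∩D≡∅ : Disjoint C D
    C∩D≡∅ with (d ∷ _) ∷ _ ← pairs = d

    C∩others≡∅ : All (Disjoint C) others
    C∩others≡∅ with (_ ∷ ds) ∷ _ ← pairs = ds

    C⊆ : C ⊆ C ∪ D
    C⊆ = Subset.p⊆p∪q D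

    D⊆ : D ⊆ C ∪ D
    D⊆ = Subset.q⊆p∪q C D

    saturated : ∀ {S} → C ⊆ S ⊎ Disjoint C S → D ⊆ S ⊎ Disjoint D S →
                All (λ B → B ⊆ S ⊎ Disjoint B S) others → Saturated Q S
    saturated c d os = ↭.All-resp-↭ (↭-sym target) (c ∷ d ∷ os)

    parent-saturated : ∀ {B} → B ∈ˡ blocks P → Saturated Q B
    parent-saturated {B} B∈ = All.tabulate λ {E} E∈ → inside-or-disjoint E B λ i∈E i∈B E⊈B →
      E⊈B (contained E∈ i∈E i∈B)
      where
      contained : ∀ {E i} → E ∈ˡ blocks Q → i ∈ E → i ∈ B → E ⊆ B
      contained E∈ i∈E i∈B with ↭.∈-resp-↭ target E∈
      ... | here ≡.refl         = subst (C ⊆_) (∈-unique (disjoint P) parent∈ B∈ (C⊆ i∈E) i∈B) C⊆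
      ... | there (here ≡.refl) = subst (D ⊆_) (∈-unique (disjoint P) parent∈ B∈ (D⊆ i∈E) i∈B) D⊆
      ... | there (there E∈o)   = Subset.⊆-reflexive (∈-unique (disjoint P) (others∈ E∈o) B∈ i∈E i∈B)

    module _ {S : Subset n} (S≡C : S ≡ C mod P) where

      private
        C⊆Redn : ∀ {c} → c ∈ C → c ∈ Redn P S
        C⊆Redn c∈C = subst (_ ∈_) (≡.sym S≡C) (∈-Redn⁺ P c∈C parent∈ (C⊆ c∈C) λ P⊆C →
          let d , d∈D = D≢∅ in ∉-Disjoint C∩D≡∅ (P⊆C (D⊆ d∈D)) d∈D)

        Redn⊆C : ∀ {i} → i ∈ Redn P S → i ∈ C
        Redn⊆C i∈ = ∈-Redn⇒∈ P (subst (_ ∈_) S≡C i∈)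

      modC⇒C⊆ : C ⊆ S
      modC⇒C⊆ c∈C = ∈-Redn⇒∈ P (C⊆Redn c∈C)

      modC⇒∉D : ∀ {d} → d ∈ D → d ∉ S
      modC⇒∉D d∈D d∈S = ∉-Disjoint C∩D≡∅ (Redn⊆C (∈-Redn⁺ P d∈S parent∈ (D⊆ d∈D)
        (∈-Redn⇒⊈ P (C⊆Redn (proj₂ C≢∅)) parent∈ (C⊆ (proj₂ C≢∅))))) d∈D

      modC⇒saturated : Saturated Q S
      modC⇒saturated = saturated (inj₁ modC⇒C⊆)
        (inj₂ λ (i , i∈) → let i∈D , i∈S = Subset.x∈p∩q⁻ D S i∈ in modC⇒∉D i∈D i∈S)
        (All.tabulate λ {B} B∈ → inside-or-disjoint B S λ i∈B i∈S B⊈S →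
          ∉-Disjoint (All.lookup C∩others≡∅ B∈) (Redn⊆C (∈-Redn⁺ P i∈S (others∈ B∈) i∈B B⊈S)) i∈B)

    saturated⇒modC : ∀ {S c d} → Saturated Q S → c ∈ C → c ∈ S → d ∈ D → d ∉ S → S ≡ C mod P
    saturated⇒modC {S} {c} {d} sat c∈C c∈S d∈D d∉S = Subset.⊆-antisym there′ back
      where
      C⊆S : C ⊆ S
      C⊆S = case All.lookup sat C∈ of λ where
        (inj₁ ⊆S) → ⊆S
        (inj₂ d)  → ⊥-elim (∉-Disjoint d c∈C c∈S)
      D∩S≡∅ : Disjoint D S
      D∩S≡∅ = case All.lookup sat D∈ of λ where
        (inj₁ ⊆S) → ⊥-elim (d∉S (⊆S d∈D))
        (inj₂ d)  → d
      back : Redn P C ⊆ Redn P S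
      back i∈ = let i∈C = ∈-Redn⇒∈ P i∈ in
        ∈-Redn⁺ P (C⊆S i∈C) parent∈ (C⊆ i∈C) (λ P⊆S → d∉S (P⊆S (D⊆ d∈D)))
      there′ : Redn P S ⊆ Redn P C
      there′ {i} i∈ =
        let i∈S = ∈-Redn⇒∈ P i∈
            B , B∈ , i∈B = blockOf Q i
        in case ↭.∈-resp-↭ target B∈ of λ where
          (here ≡.refl)         → ∈-Redn⁺ P i∈B parent∈ (C⊆ i∈B) λ P⊆C → ∉-Disjoint C∩D≡∅ (P⊆C (D⊆ d∈D)) d∈D
          (there (here ≡.refl)) → ⊥-elim (∉-Disjoint D∩S≡∅ i∈B i∈S)
          (there (there B∈o))   → case All.lookup sat B∈ of λ where
            (inj₁ B⊆S) → ⊥-elim (∈-Redn⇒⊈ P i∈ (others∈ B∈o) i∈B B⊆S)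
            (inj₂ d)   → ⊥-elim (∉-Disjoint d i∈B i∈S)

  module CutFace {P Q : Partition n} (V : Cut P Q) (X : Face Q) where

    private
      module X = Face X
      module V = CutProperties V
      module V̄ = CutProperties (opposite V)
    open Cut V using (C; D)

    -- When none of the first three cases applies, S ≠ ∅ mod Q; the third case is
    -- S = ∅ mod P, because S = ∅ mod Q means that S is ∅, C or D mod P.
    cutSign : Subset n → Sign
    cutSign S =
      if does (S ≡ C mod? P) then pos else
      if does (S ≡ D mod? P) then neg else
      if does (S ≡ Subset.⊥ mod? Q) then zer else
      X.sign S

    private
      c d : Fin n
      c = proj₁ V.C≢∅
      d = proj₁ V.D≢∅

      c∈C : c ∈ C
      c∈C = proj₂ V.C≢∅

      d∈D : d ∈ D
      d∈D = proj₂ V.D≢∅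

      u : Vector
      u = transfer c d

      saturated-u : ∀ {S t h} → T∨[ Q ] h → Saturated Q S → total S (λ i → t * h i + u i) ≈ total S u
      saturated-u {S} {t} {h} h∈T sat = begin
        total S (λ i → t * h i + u i)   ≈⟨ total-linear S t h u ⟩
        t * total S h + total S u       ≈⟨ +-congʳ (trans (*-congˡ (saturated-total Q h∈T sat)) (zeroʳ t)) ⟩
        0# + total S u                  ≈⟨ +-identityˡ _ ⟩
        total S u                       ∎
        where open ≈-Reasoning

      eventually : ∀ {h} → Realizes X.sign h → ∀ S →
                   Eventually (λ t → HasSign (total S (λ i → t * h i + u i)) (cutSign S))
      eventually {h} r S with S ≡ C mod? P
      ... | yes S≡C = 0# , λ t _ → HasSign-≈
        (sym (trans (saturated-u {t = t} (realizes⇒T∨ X r) (V.modC⇒saturated S≡C))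
                    (transfer-in (V.modC⇒C⊆ S≡C c∈C) (V.modC⇒∉D S≡C d∈D))))
        (is-pos 0<1)
      ... | no S≢C with S ≡ D mod? P
      ...   | yes S≡D = 0# , λ t _ → HasSign-≈
        (sym (trans (saturated-u {t = t} (realizes⇒T∨ X r) (V̄.modC⇒saturated S≡D))
                    (transfer-out (V̄.modC⇒∉D S≡D c∈C) (V̄.modC⇒C⊆ S≡D d∈D))))
        (is-neg -1<0)
      ...   | no S≢D with S ≡ Subset.⊥ mod? Q
      ...     | no S≢∅ =
        let t₀ , large = eventually-sign (total S u) (not-null⇒≢zer X S≢∅) (proj₂ r S)
        in t₀ , λ t lt → HasSign-≈ (sym (total-linear S t h u)) (large t lt)
      ...     | yes S≡∅ = 0# , λ t _ → is-zer (trans (saturated-u {t = t} (realizes⇒T∨ X r) sat) u≈0)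
        where
        sat : Saturated Q S
        sat = null⇒saturated Q S≡∅
        u≈0 : total S u ≈ 0#
        u≈0 with c Subset.∈? S | d Subset.∈? S
        ... | yes c∈ | yes d∈ = transfer-both c∈ d∈
        ... | yes c∈ | no  d∉ = ⊥-elim (S≢C (V.saturated⇒modC sat c∈C c∈ d∈D d∉))
        ... | no  c∉ | yes d∈ = ⊥-elim (S≢D (V̄.saturated⇒modC sat d∈D d∈ c∈C c∉))
        ... | no  c∉ | no  d∉ = transfer-neither c∉ d∉

      ⊤-saturated : Saturated Q Subset.⊤
      ⊤-saturated = All.tabulate λ {B} _ → inj₁ (Subset.⊆⊤ {p = B})

      eventually-realizes : ∀ {h} → Realizes X.sign h →
                            Eventually (λ t → Realizes cutSign (λ i → t * h i + u i))
      eventually-realizes {h} r =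
        let t₀ , large = uniformly (eventually r)
        in t₀ , λ t lt → trans (saturated-u {t = t} (realizes⇒T∨ X r) ⊤-saturated)
                               (transfer-both {c} {d} Subset.∈⊤ Subset.∈⊤)
                       , large t lt

      cutPoint : ∃ (Realizes cutSign)
      cutPoint = let t₀ , large = eventually-realizes (proj₂ X.point) in
        _ , large (t₀ + 1#) (x<x+1 t₀)

      sign-block : ∀ {B} → B ∈ˡ blocks P → cutSign B ≡ zer
      sign-block {B} B∈ = let t₀ , large = eventually-realizes (proj₂ X.point) in
        zero-sign (trans (saturated-u {t = t₀ + 1#} (realizes⇒T∨ X (proj₂ X.point)) (V.parent-saturated B∈)) u≈0)
                  (proj₂ (large (t₀ + 1#) (x<x+1 t₀)) B)
        where
        u≈0 : total B u ≈ 0#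
        u≈0 with ↭.∈-resp-↭ V.source B∈
        ... | here ≡.refl = transfer-both (V.C⊆ c∈C) (V.D⊆ d∈D)
        ... | there B∈o   = transfer-neither (∉-Disjoint (All.lookup V.C∩others≡∅ B∈o) c∈C)
                                             (∉-Disjoint (All.lookup V̄.C∩others≡∅ B∈o) d∈D)

      Span-u-and-X : Span (Realizes cutSign) u × (∀ {h} → Realizes X.sign h → Span (Realizes cutSign) h)
      Span-u-and-X = span-u , span-X
        where
        span-X : ∀ {h} → Realizes X.sign h → Span (Realizes cutSign) h
        span-X {h} r =
          let t₀ , large = eventually-realizes r
              t = t₀ + 1#
              t₀<t = x<x+1 t₀
          in Span-linear (- 1#) (Span-gen (large t t₀<t))
               (Span-gen (large (t + 1#) (<-trans t₀<t (x<x+1 t))))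
               (λ i → sym (difference t (h i) (u i)))
          where
          difference : ∀ t x y → - 1# * (t * x + y) + ((t + 1#) * x + y) ≈ x
          difference t x y = begin
            - 1# * (t * x + y) + ((t + 1#) * x + y)        ≈⟨ +-cong (trans (sym (-‿distribˡ-* 1# _)) (-‿cong (*-identityˡ _)))
                                                                     (+-congʳ (trans (distribʳ x t 1#) (+-cong refl (*-identityˡ x)))) ⟩
            - (t * x + y) + ((t * x + x) + y)              ≈⟨ +-congˡ (trans (+-assoc _ _ _) (trans (+-congˡ (+-comm x y)) (sym (+-assoc _ _ _)))) ⟩
            - (t * x + y) + ((t * x + y) + x)              ≈⟨ +-assoc _ _ _ ⟨
            (- (t * x + y) + (t * x + y)) + x              ≈⟨ +-congʳ (-‿inverseˡ _) ⟩
            0# + x                                         ≈⟨ +-identityˡ x ⟩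
            x                                              ∎
            where open ≈-Reasoning
        span-u : Span (Realizes cutSign) u
        span-u =
          let h , r = X.point
              t₀ , large = eventually-realizes r
              t = t₀ + 1#
          in Span-linear (- t) (span-X r) (Span-gen (large t (x<x+1 t₀)))
               (λ i → sym (cancel t (h i) (u i)))
          where
          cancel : ∀ t x y → - t * x + (t * x + y) ≈ y
          cancel t x y = trans (sym (+-assoc _ _ _)) (trans
            (+-congʳ (trans (+-congʳ (sym (-‿distribˡ-* t x))) (-‿inverseˡ _))) (+-identityˡ y))

      T∨⊆ : ∀ {v} → T∨[ P ] v → Span (Realizes cutSign) v
      T∨⊆ {v} v∈T = Span-linear a (proj₁ Span-u-and-X)
        (Span-bind (proj₂ Span-u-and-X) (proj₂ X.hasSupport w∈T))
        (λ i → sym (add-back (u i) (v i)))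
        where
        a : Carrier
        a = total C v
        w : Vector
        w i = - a * u i + v i
        add-back : ∀ x y → a * x + (- a * x + y) ≈ y
        add-back x y = trans (sym (+-assoc _ _ _)) (trans
          (+-congʳ (trans (+-congˡ (sym (-‿distribˡ-* a x))) (-‿inverseʳ _))) (+-identityˡ y))
        total-w : ∀ B {x y} → total B u ≈ x → total B v ≈ y → total B w ≈ - a * x + y
        total-w B ex ey = trans (total-linear B (- a) u v) (+-cong (*-congˡ ex) ey)
        others-zero : ∀ {B} → B ∈ˡ V.others → total B w ≈ 0#
        others-zero {B} B∈ = trans
          (total-w B (transfer-neither (∉-Disjoint (All.lookup V.C∩others≡∅ B∈) c∈C)
                                       (∉-Disjoint (All.lookup V̄.C∩others≡∅ B∈) d∈D))
                     (All.lookup v∈T (V.others∈ B∈)))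
          (trans (+-identityʳ _) (zeroʳ (- a)))
        C-zero : total C w ≈ 0#
        C-zero = trans
          (total-w C (transfer-in c∈C (λ d∈C → ∉-Disjoint V.C∩D≡∅ d∈C d∈D)) refl)
          (trans (+-congʳ (*-identityʳ (- a))) (-‿inverseˡ a))
        D-zero : total D w ≈ 0#
        D-zero = trans
          (total-w D (transfer-out (λ c∈D → ∉-Disjoint V.C∩D≡∅ c∈C c∈D) d∈D) refl)
          (begin
            - a * - 1# + total D v    ≈⟨ +-congʳ (-‿distribʳ-* (- a) 1#) ⟨
            - (- a * 1#) + total D v  ≈⟨ +-congʳ (-‿cong (*-identityʳ (- a))) ⟩
            - (- a) + total D v       ≈⟨ +-congʳ (-‿involutive a) ⟩
            a + total D v             ≈⟨ total-∪ C D v V.C∩D≡∅ ⟨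
            total (C ∪ D) v           ≈⟨ All.lookup v∈T V.parent∈ ⟩
            0#                        ∎)
          where open ≈-Reasoning
        w∈T : T∨[ Q ] w
        w∈T = ↭.All-resp-↭ (↭-sym V.target) (C-zero ∷ D-zero ∷ All.tabulate others-zero)

    cutFace : Face P
    cutFace = record
      { adjointFace = record { sign = cutSign ; point = cutPoint }
      ; hasSupport  = (λ sv → All.tabulate λ {B} B∈ →
                        Span-total {S = B} (λ r → sign-zero (sign-block B∈) (proj₂ r B)) sv)
                    , T∨⊆
      }

  infix 25 _^_

  _^_ : {P Q : Partition n} → Face Q → Cut P Q → Face P
  X ^ V = CutFace.cutFace V X

  ^-cong : {P Q : Partition n} (V : Cut P Q) {X Y : Face Q} →
           Setoid._≈_ (faceSetoid Q) X Y → Setoid._≈_ (faceSetoid P) (X ^ V) (Y ^ V)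
  ^-cong {P} {Q} V e S = cong
    (λ s → if does (S ≡ C mod? P) then pos else
           if does (S ≡ D mod? P) then neg else
           if does (S ≡ Subset.⊥ mod? Q) then zer else s) (e S)
    where open Cut V

module Functionals {c ℓ r₁ r₂ r₃} (K : Field c ℓ) (R : OrderedField r₁ r₂ r₃) (n : ℕ) where

  open Field K
    using (_≈_; _+_; _*_; -_; _-_; +-cong; +-congˡ; +-congʳ; +-assoc; +-comm; -‿cong; distribˡ; refl; trans; sym)
  open RingProperties (Field.ring K) using (-‿+-comm; -‿distribʳ-*)
  open LinearAlgebra K public
  open Arrangement R n public

  L∨ : Partition n → VectorSpace _ _
  L∨ P = Free (faceSetoid P)

  L∨* : Partition n → VectorSpace _ _
  L∨* P = Dual (L∨ P)

  Functional : Partition n → Set _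
  Functional P = LeftModule.Carrierᴹ (L∨* P)

  infixl 20 _⟨_⟩

  _⟨_⟩ : {P : Partition n} → Functional P → Face P → Field.Carrier K
  f ⟨ X ⟩ = f · gen X

  _≈ᶠ_ : {P : Partition n} → Rel (Face P) 0ℓ
  _≈ᶠ_ {P} = Setoid._≈_ (faceSetoid P)

  ⟨⟩-cong : ∀ {P} (f : Functional P) {X Y : Face P} → X ≈ᶠ Y → f ⟨ X ⟩ ≈ f ⟨ Y ⟩
  ⟨⟩-cong {P} f e = _⊸_.⟦⟧-cong f (gen-cong (faceSetoid P) e)

  functional : ∀ {P} (φ : Face P → Field.Carrier K) →
               (∀ {X Y} → X ≈ᶠ Y → φ X ≈ φ Y) → Functional P
  functional {P} = extend (faceSetoid P) {W = scalars}

  ≗ₗ-on-faces : ∀ {P} (f g : Functional P) → (∀ X → f ⟨ X ⟩ ≈ g ⟨ X ⟩) → f ≗ₗ g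
  ≗ₗ-on-faces {P} = FreeSpace.≗ₗ-on-generators (faceSetoid P)

  private
    infixl 6 _+*_
    infixr 7 _**_

    _+*_ : ∀ {P} → Functional P → Functional P → Functional P
    _+*_ {P} = LeftModule._+ᴹ_ (L∨* P)

    _**_ : ∀ {P} → Field.Carrier K → Functional P → Functional P
    _**_ {P} = LeftModule._*ₗ_ (L∨* P)

    sub-+ : ∀ w x y z → (w + x) - (y + z) ≈ (w - y) + (x - z)
    sub-+ w x y z = begin
      (w + x) - (y + z)           ≈⟨ +-congˡ (-‿+-comm y z) ⟨
      (w + x) + (- y + - z)       ≈⟨ +-assoc w x _ ⟩
      w + (x + (- y + - z))       ≈⟨ +-congˡ (+-assoc x (- y) (- z)) ⟨
      w + ((x + - y) + - z)       ≈⟨ +-congˡ (+-congʳ (+-comm x (- y))) ⟩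
      w + ((- y + x) + - z)       ≈⟨ +-congˡ (+-assoc (- y) x (- z)) ⟩
      w + (- y + (x - z))         ≈⟨ +-assoc w (- y) _ ⟨
      (w - y) + (x - z)           ∎
      where open SetoidReasoning (Field.setoid K)

    sub-* : ∀ a x y → (a * x) - (a * y) ≈ a * (x - y)
    sub-* a x y = trans (+-congˡ (-‿distribʳ-* a y)) (sym (distribˡ a x (- y)))

  -- Partitions with the same blocks have the same adjoint faces.
  recast* : {P Q : Partition n} → P ≈ᴾ Q → L∨* P ⊸ L∨* Q
  recast* {P} {Q} P≈Q = mkLinear φ
    (λ {f} {g} e → ≗ₗ-on-faces (φ f) (φ g) λ X → e (gen (recast (↭-sym P≈Q) X)))
    (λ f g → ≗ₗ-on-faces (φ (f +* g)) (φ f +* φ g) λ _ → refl)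
    (λ a f → ≗ₗ-on-faces (φ (a ** f)) (a ** φ f) λ _ → refl)
    where
    φ : Functional P → Functional Q
    φ f = functional (λ X → f ⟨ recast (↭-sym P≈Q) X ⟩) λ {X} {Y} e →
      ⟨⟩-cong f {recast (↭-sym P≈Q) X} {recast (↭-sym P≈Q) Y} e

  ∂ᶜ : {P Q : Partition n} → Cut P Q → L∨* P ⊸ L∨* Q
  ∂ᶜ {P} {Q} V = mkLinear φ
    (λ {f} {g} e → ≗ₗ-on-faces (φ f) (φ g) λ X →
      +-cong (e (gen (X ^ V))) (-‿cong (e (gen (X ^ opposite V)))))
    (λ f g → ≗ₗ-on-faces (φ (f +* g)) (φ f +* φ g) λ X →
      sub-+ (f ⟨ X ^ V ⟩) (g ⟨ X ^ V ⟩) (f ⟨ X ^ opposite V ⟩) (g ⟨ X ^ opposite V ⟩))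
    (λ a f → ≗ₗ-on-faces (φ (a ** f)) (a ** φ f) λ X →
      sub-* a (f ⟨ X ^ V ⟩) (f ⟨ X ^ opposite V ⟩))
    where
    φ : Functional P → Functional Q
    φ f = functional (λ X → f ⟨ X ^ V ⟩ - f ⟨ X ^ opposite V ⟩) λ {X} {Y} e →
      +-cong (⟨⟩-cong f {X ^ V} {Y ^ V} (^-cong V {X} {Y} e))
             (-‿cong (⟨⟩-cong f {X ^ opposite V} {Y ^ opposite V} (^-cong (opposite V) {X} {Y} e)))

  ∂ˢ : {P Q : Partition n} → Cuts P Q → L∨* P ⊸ L∨* Q
  ∂ˢ (done e) = recast* e
  ∂ˢ (V ⟫ Vs) = ∂ˢ Vs ∘ₗ ∂ᶜ V

  ∂ : {P Q : Partition n} → LayeredForest P Q → L∨* P ⊸ L∨* Q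
  ∂ F = ∂ˢ (decompose F)

  module _ (P Q : Partition n) (Q≼P : Q ≼ P) {Qs : Fin (size P) → Partition n}
           (Qs≈ : ∀ j → Qs j ≈ᴾ component P Q Q≼P j) where

    restrictTo : Face Q → ∀ j → Face (Qs j)
    restrictTo X j = recast (↭-sym (Qs≈ j)) (restriction X (≼⇒Saturated P Q Q≼P j))

    -- prod_P, for given presentations Qs j of the partitions ᴵQⱼ.
    prod : ⨂ (λ j → L∨* (Qs j)) ⊸ L∨* Q
    prod = lift (L∨* Q) φ λ where
        (⊗-cong {f} {g} e)              → ≗ₗ-on-faces (φ f) (φ g) λ X → Π-cong λ j → e j (gen (restrictTo X j))
        (⊗-add j {f} {g} {h} e p q)     → ≗ₗ-on-faces (φ h) (LeftModule._+ᴹ_ (L∨* Q) (φ f) (φ g)) λ X →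
          Π-add j (e (gen (restrictTo X j))) (λ i i≢j → p i i≢j (gen (restrictTo X i)))
                                              (λ i i≢j → q i i≢j (gen (restrictTo X i)))
        (⊗-scale j a {f} {h} e p)       → ≗ₗ-on-faces (φ h) (LeftModule._*ₗ_ (L∨* Q) a (φ f)) λ X →
          Π-scale j a (e (gen (restrictTo X j))) (λ i i≢j → p i i≢j (gen (restrictTo X i)))
      where
      open TensorProduct (λ j → L∨* (Qs j)) using (Family; Multilinear)
      open Presented Family Multilinear using (lift)
      φ : (∀ j → Functional (Qs j)) → Functional Q
      φ f = functional (λ X → Π λ j → f j ⟨ restrictTo X j ⟩) λ {X} {Y} e →
        Π-cong λ j → ⟨⟩-cong (f j) {restrictTo X j} {restrictTo Y j} λ S → e (S ∩ block P j)

{-# OPTIONS --safe #-}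

-- A cut V of a block contained in Sₘ commutes with restriction: (X^V)|Sₘ is
-- (X|Sₘ)^V, while (X^V)|Sⱼ = X|Sⱼ for j ≠ m.  Hence ∂_V of an external product
-- replaces the m-th factor by its derivative and leaves the others unchanged;
-- induct on the cuts of F, each of which belongs to one tree.
module Submission where

open import Defs
open import Data.Bool.Base using (if_then_else_)
open import Data.Empty using (⊥-elim)
open import Data.Fin.Base using (Fin; zero; suc)
import Data.Fin.Properties as Fin
open import Data.Fin.Subset using (Subset; ⊥; ⁅_⁆; _∈_; _∉_; _⊆_; _∩_; _∪_; Nonempty)
import Data.Fin.Subset.Properties as Subset
open import Data.List.Base using (List; []; _∷_; _++_; filter; mapMaybe)
open import Data.List.Membership.Propositional using () renaming (_∈_ to _∈ˡ_)
import Data.List.Membership.Propositional.Properties as ∈ˡ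
import Data.List.Properties as List
open import Data.List.Relation.Binary.Permutation.Propositional
  using (_↭_; ↭-refl; ↭-sym; ↭-trans; ↭-reflexive; prep)
import Data.List.Relation.Binary.Permutation.Propositional.Properties as ↭
open import Data.List.Relation.Unary.All as All using (All; []; _∷_)
import Data.List.Relation.Unary.All.Properties as All
open import Data.List.Relation.Unary.AllPairs using (AllPairs; []; _∷_)
import Data.List.Relation.Unary.Any as Any
import Data.List.Relation.Unary.Any.Properties as Any
open import Data.List.Relation.Unary.Unique.Propositional using (Unique)
open import Data.Nat.Base using (ℕ)
open import Data.Product.Base using (∃; _×_; _,_; proj₁; proj₂; swap)
open import Data.Sum.Base using (_⊎_; inj₁; inj₂)
open import Function.Base using (_∘_)
open import Function.Bundles using (_⇔_; mk⇔)
import Level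
open import Relation.Binary.PropositionalEquality as ≡ using (_≡_; _≢_; cong; cong₂; subst)
import Relation.Binary.Reasoning.Setoid as SetoidReasoning
open import Relation.Nullary using (¬_; yes; no; does)
open import Relation.Nullary.Decidable using (dec-false; does-⇔)

private
  variable
    n : ℕ
    P P′ Q Q′ : Partition n

-- Cut sequences and the subsequence inside one block.

SameSplit : {P Q P′ Q′ : Partition n} → Cut P Q → Cut P′ Q′ → Set
SameSplit V W = Cut.C V ≡ Cut.C W × Cut.D V ≡ Cut.D W

-- The second sequence consists of the cuts of the first that split a block inside `S`. Matched cuts
-- are compared by `C` and `D` only, because the two sequences act on partitions with different
-- blocks outside `S`; `Stage` records how those partitions correspond.
data Component {n : ℕ} (S : Subset n) :
     {P Q P′ Q′ : Partition n} → Cuts P Q → Cuts P′ Q′ → Set where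
  done : ∀ {P Q P′ Q′ : Partition n} {e : P ≈ᴾ Q} {e′ : P′ ≈ᴾ Q′} →
         Component S {P} {Q} {P′} {Q′} (done e) (done e′)
  skip : ∀ {P T Q P′ Q′ : Partition n} {V : Cut P T} {Vs : Cuts T Q} {Ws : Cuts P′ Q′} →
         Disjoint (Cut.C V ∪ Cut.D V) S → Component S Vs Ws → Component S (V ⟫ Vs) Ws
  take : ∀ {P T Q P′ T′ Q′ : Partition n} {V : Cut P T} {Vs : Cuts T Q}
           {W : Cut P′ T′} {Ws : Cuts T′ Q′} →
         Cut.C V ∪ Cut.D V ⊆ S → SameSplit V W → Component S Vs Ws →
         Component S (V ⟫ Vs) (W ⟫ Ws)

-- Cuts and the restriction of partitions to a saturated set.

Disjoint-∪ : (C D : Subset n) {S : Subset n} → Disjoint (C ∪ D) S → Disjoint C S × Disjoint D S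
Disjoint-∪ C D d = Disjoint-⊆ C (C ∪ D) (Subset.p⊆p∪q D) d , Disjoint-⊆ D (C ∪ D) (Subset.q⊆p∪q C D) d

⊆-∪ : (C D : Subset n) {S : Subset n} → C ∪ D ⊆ S → C ⊆ S × D ⊆ S
⊆-∪ C D s = (λ i∈ → s (Subset.p⊆p∪q D i∈)) , (λ i∈ → s (Subset.q⊆p∪q C D i∈))

cut-nonempty : (V : Cut P Q) → Nonempty (Cut.C V) × Nonempty (Cut.D V)
cut-nonempty {Q = Q} V with C≢∅ ∷ D≢∅ ∷ _ ← ↭.All-resp-↭ (Cut.target V) (nonempty Q) = C≢∅ , D≢∅

parent-nonempty : (V : Cut P Q) → Nonempty (Cut.C V ∪ Cut.D V)
parent-nonempty V = let i , i∈C = proj₁ (cut-nonempty V) in i , Subset.p⊆p∪q (Cut.D V) i∈C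

cut-≼ : (P₀ : Partition n) (V : Cut P Q) → P ≼ P₀ → Q ≼ P₀
cut-≼ P₀ V P≼ with CD ∷ os ← ↭.All-resp-↭ (Cut.source V) P≼ = ↭.All-resp-↭ (↭-sym (Cut.target V))
  (Any.map (λ {B} (s : Cut.C V ∪ Cut.D V ⊆ B) {_} → proj₁ (⊆-∪ (Cut.C V) (Cut.D V) s)) CD ∷
   Any.map (λ {B} (s : Cut.C V ∪ Cut.D V ⊆ B) {_} → proj₂ (⊆-∪ (Cut.C V) (Cut.D V) s)) CD ∷ os)

cut-saturated : (V : Cut P Q) {S : Subset n} → Saturated P S → Saturated Q S
cut-saturated V {S} sat with CD ∷ os ← ↭.All-resp-↭ (Cut.source V) sat =
  ↭.All-resp-↭ (↭-sym (Cut.target V)) (proj₁ (halves CD) ∷ proj₂ (halves CD) ∷ os)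
  where
  C = Cut.C V
  D = Cut.D V
  halves : C ∪ D ⊆ S ⊎ Disjoint (C ∪ D) S → (C ⊆ S ⊎ Disjoint C S) × (D ⊆ S ⊎ Disjoint D S)
  halves (inj₁ s) = let c , d = ⊆-∪ C D s in inj₁ c , inj₁ d
  halves (inj₂ s) = let c , d = Disjoint-∪ C D s in inj₂ c , inj₂ d

module _ (V : Cut P Q) {S : Subset n} (sat : Saturated P S) where
  open Cut V

  private
    inside? = Subset._⊆? S

  -- `C`, `D` and `C ∪ D` are nonempty and disjoint from `S`, so none of them survives the filter:
  -- the cut is invisible inside `S`.
  restrict-skip : (P′ : Partition _) → Disjoint (C ∪ D) S →
                  P′ ≈ᴾ (P ↾ S by sat) → P′ ≈ᴾ (Q ↾ S by cut-saturated V sat)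
  restrict-skip P′ CD e = ↭-trans e (↭.++⁺ʳ (singletonsOutside S)
    (↭-trans (↭.filter-↭ inside? source) (↭-trans (↭-reflexive same)
      (↭-sym (↭.filter-↭ inside? target)))))
    where
    open ≡.≡-Reasoning
    C≢∅ = proj₁ (cut-nonempty V)
    D≢∅ = proj₂ (cut-nonempty V)
    same : filter inside? (C ∪ D ∷ others) ≡ filter inside? (C ∷ D ∷ others)
    same = begin
      filter inside? (C ∪ D ∷ others)   ≡⟨ List.filter-reject inside? (⊈-Disjoint (parent-nonempty V) CD) ⟩
      filter inside? others             ≡⟨ List.filter-reject inside? (⊈-Disjoint D≢∅ (proj₂ (Disjoint-∪ C D CD))) ⟨
      filter inside? (D ∷ others)       ≡⟨ List.filter-reject inside? (⊈-Disjoint C≢∅ (proj₁ (Disjoint-∪ C D CD))) ⟨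
      filter inside? (C ∷ D ∷ others)   ∎

  -- As `C ∪ D` lies in `S`, the filter keeps the parent before the cut and both halves after it.
  restrict-take : C ∪ D ⊆ S → (W : Cut P′ Q′) → SameSplit V W →
                  P′ ≈ᴾ (P ↾ S by sat) → Q′ ≈ᴾ (Q ↾ S by cut-saturated V sat)
  restrict-take {P′ = P′} CD W (C≡ , D≡) e =
    ↭-trans (Cut.target W) (↭-trans
      (↭-reflexive (cong₂ (λ A B → A ∷ B ∷ Cut.others W) (≡.sym C≡) (≡.sym D≡)))
      (↭-trans (prep C (prep D others↭)) (↭-trans (↭-reflexive (cong (_++ singletonsOutside S) (≡.sym children)))
        (↭.++⁺ʳ (singletonsOutside S) (↭-sym (↭.filter-↭ inside? target))))))
    where
    parent : filter inside? (C ∪ D ∷ others) ≡ C ∪ D ∷ filter inside? others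
    parent = List.filter-accept inside? CD
    children : filter inside? (C ∷ D ∷ others) ≡ C ∷ D ∷ filter inside? others
    children = ≡.trans (List.filter-accept inside? (proj₁ (⊆-∪ C D CD)))
                       (cong (C ∷_) (List.filter-accept inside? (proj₂ (⊆-∪ C D CD))))
    source′ : blocks P′ ↭ C ∪ D ∷ Cut.others W
    source′ = ↭-trans (Cut.source W)
      (↭-reflexive (cong₂ (λ A B → A ∪ B ∷ Cut.others W) (≡.sym C≡) (≡.sym D≡)))
    others↭ : Cut.others W ↭ filter inside? others ++ singletonsOutside S
    -- Both enumerations of the blocks of `P′` start with the parent block; cancelling it identifies
    -- the blocks that `W` leaves alone.
    others↭ = ↭.drop-∷ (↭-trans (↭-sym source′) (↭-trans e
      (↭.++⁺ʳ (singletonsOutside S) (↭-trans (↭.filter-↭ inside? source) (↭-reflexive parent)))))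

module _ (Q Q′ : Partition n) {S : Subset n} (sat : Saturated Q S)
         (e : Q′ ≈ᴾ (Q ↾ S by sat)) {E : Subset n} where

  -- Blocks of `Q` outside `S` miss `E ∩ S`, and those inside `S` are blocks of `Q′`. Together with
  -- its converse this carries congruences to `C` or `D`, rephrased through saturation, across
  -- restriction.
  saturated-∩⁺ : Saturated Q′ E → Saturated Q (E ∩ S)
  saturated-∩⁺ satE = All.tabulate λ {B} B∈ → case-block B∈ (All.lookup sat B∈)
    where
    case-block : ∀ {B} → B ∈ˡ blocks Q → B ⊆ S ⊎ Disjoint B S → B ⊆ E ∩ S ⊎ Disjoint B (E ∩ S)
    case-block {B} B∈ (inj₂ d)   = inj₂ (Disjoint-sym (Disjoint-⊆ (E ∩ S) S (Subset.p∩q⊆q E S) (Disjoint-sym d)))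
    case-block {B} B∈ (inj₁ B⊆S)
      with All.lookup satE (↭.∈-resp-↭ (↭-sym e) (∈ˡ.∈-++⁺ˡ (∈ˡ.∈-filter⁺ (Subset._⊆? S) B∈ B⊆S)))
    ... | inj₁ B⊆E = inj₁ λ i∈ → Subset.x∈p∩q⁺ (B⊆E i∈ , B⊆S i∈)
    ... | inj₂ d   = inj₂ (Disjoint-sym (Disjoint-⊆ (E ∩ S) E (Subset.p∩q⊆p E S) (Disjoint-sym d)))

  -- Besides the blocks of `Q` inside `S`, `Q′` has only singletons, and a singleton is contained in
  -- or disjoint from any `E`.
  saturated-∩⁻ : Saturated Q (E ∩ S) → Saturated Q′ E
  saturated-∩⁻ satE∩S = ↭.All-resp-↭ (↭-sym e) (All.++⁺
    (All.tabulate λ {B} B∈ → inside (∈ˡ.∈-filter⁻ (Subset._⊆? S) {xs = blocks Q} B∈))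
    (All.map⁺ (All.universal singleton _)))
    where
    inside : ∀ {B} → B ∈ˡ blocks Q × B ⊆ S → B ⊆ E ⊎ Disjoint B E
    inside {B} (B∈ , B⊆S) with All.lookup satE∩S B∈
    ... | inj₁ B⊆ = inj₁ λ i∈ → Subset.p∩q⊆p E S (B⊆ i∈)
    ... | inj₂ d  = inj₂ λ (i , i∈) → let i∈B , i∈E = Subset.x∈p∩q⁻ B E i∈ in
      ∉-Disjoint d i∈B (Subset.x∈p∩q⁺ (i∈E , B⊆S i∈B))
    singleton : ∀ i → ⁅ i ⁆ ⊆ E ⊎ Disjoint ⁅ i ⁆ E
    singleton i with i Subset.∈? E
    ... | yes i∈E = inj₁ λ x∈ → subst (_∈ E) (≡.sym (Subset.x∈⁅y⁆⇒x≡y i x∈)) i∈E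
    ... | no  i∉E = inj₂ λ (x , x∈) → let x∈i , x∈E = Subset.x∈p∩q⁻ ⁅ i ⁆ E x∈ in
      i∉E (subst (_∈ E) (Subset.x∈⁅y⁆⇒x≡y i x∈i) x∈E)

-- The cuts of a forest at the nodes of one tree.

split-⊆ : {S : Subset n} {t : Tree S} (x : Node t) → leftOf x ∪ rightOf x ⊆ S
split-⊆ root                                = λ i∈ → i∈
split-⊆ {t = node {C} {D} _ l r} (left x)  i∈ = Subset.p⊆p∪q D (split-⊆ x i∈)
split-⊆ {t = node {C} {D} _ l r} (right x) i∈ = Subset.q⊆p∪q C D (split-⊆ x i∈)

block-disjoint : (P : Partition n) {i j : Fin (size P)} → i ≢ j → Disjoint (block P i) (block P j)
block-disjoint P i≢j = AllPairs-lookup Disjoint-sym (disjoint P) i≢j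

module _ {P Q : Partition n} (F : LayeredForest P Q) (j : Fin (size P)) where
  open Completion F j hiding (complete-at)
  open LayeredForest F using (tree)
  open Family using (_◁ᶠ_)
  private
    module D  = Decomposition F
    module D′ = Decomposition (complete-at F j)
    Nodes  = Family.ForestNode tree
    Nodes′ = Family.ForestNode completedTree

  -- Recursion over the nodes still to be cut: a node of another tree splits a set disjoint from
  -- `S`, while a node of the `j`-th tree is cut in both runs. The current partitions and the
  -- certificates can be arbitrary, since only the split sets are compared. `ys` enters through an
  -- equation, so that deciding `i Fin.≟ j` settles whether the node occurs in it.
  component-cutAlong :
    (xs : List Nodes) (u : Unique xs) (p : AllPairs (λ x y → ¬ _◁ᶠ_ tree y x) xs)
    (closed : ∀ {x y} → x ∈ˡ xs → _◁ᶠ_ tree x y → y ∈ˡ xs)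
    (R : Partition n) (e : blocks R ↭ D.forestFrontier xs)
    {ys : List Nodes′} (ys≡ : mapMaybe select xs ≡ ys)
    (u′ : Unique ys) (p′ : AllPairs (λ x y → ¬ _◁ᶠ_ completedTree y x) ys)
    (closed′ : ∀ {x y} → x ∈ˡ ys → _◁ᶠ_ completedTree x y → y ∈ˡ ys)
    (R′ : Partition n) (e′ : blocks R′ ↭ D′.forestFrontier ys) →
    Component S (D.cutAlong xs u p closed R e) (D′.cutAlong ys u′ p′ closed′ R′ e′)
  component-cutAlong [] _ _ _ R e ≡.refl _ _ _ R′ e′ = done
  component-cutAlong ((i , x) ∷ xs) u p closed R e ys≡ u′ p′ closed′ R′ e′ with i Fin.≟ j
  component-cutAlong ((i , x) ∷ xs) (_ ∷ u) (_ ∷ p) closed R e ys≡ u′ p′ closed′ R′ e′ | no i≢j =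
    skip (Disjoint-⊆ (leftOf x ∪ rightOf x) (block P i) (split-⊆ x) (block-disjoint P i≢j))
         (component-cutAlong xs u p _ _ _ ys≡ u′ p′ closed′ R′ e′)
  component-cutAlong ((.j , x) ∷ xs) (_ ∷ u) (_ ∷ p) closed R e ≡.refl (_ ∷ u′) (_ ∷ p′) closed′ R′ e′ | yes ≡.refl =
    take (split-⊆ x) (≡.refl , ≡.refl)
         (component-cutAlong xs u p _ _ _ ≡.refl u′ p′ _ _ _)

  component-decompose : Component S (decompose F) (decompose (complete-at F j))
  component-decompose = component-cutAlong _ _ _ _ _ _ ≡.refl _ _ _ _ _

-- Cut faces and their restrictions.

module ProductRule {c ℓ r₁ r₂ r₃} (K : Field c ℓ) (R : OrderedField r₁ r₂ r₃) (n : ℕ) where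
  open Functionals K R n
  open Field K using (_≈_; _+_; _-_; -_; setoid; +-cong; +-congˡ; +-congʳ; -‿cong; -‿inverseˡ; -‿inverseʳ;
    +-identityʳ; +-assoc; refl; reflexive; sym; trans)

  -- The derivative in additive form, the shape that `Π-add` takes.
  ∂ᶜ-raise : {P Q : Partition n} (V : Cut P Q) (f : Functional P) (X : Face Q) →
             f ⟨ X ^ V ⟩ ≈ (∂ᶜ V · f) ⟨ X ⟩ + f ⟨ X ^ opposite V ⟩
  ∂ᶜ-raise V f X = sub-add (f ⟨ X ^ V ⟩) (f ⟨ X ^ opposite V ⟩)
    where
    sub-add : ∀ x y → x ≈ (x - y) + y
    sub-add x y = sym (trans (+-assoc x (- y) y) (trans (+-congˡ (-‿inverseˡ y)) (+-identityʳ x)))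

  -- The case of sets that are empty mod `Q` can be merged into the last one: such sets are
  -- saturated, so `X` already has sign zero there.
  sign-^ : {P Q : Partition n} (V : Cut P Q) (X : Face Q) (E : Subset n) → Face.sign (X ^ V) E ≡
    (if does (E ≡ Cut.C V mod? P) then pos else
     if does (E ≡ Cut.D V mod? P) then neg else Face.sign X E)
  sign-^ {P} {Q} V X E with E ≡ ⊥ mod? Q
  ... | no  _   = ≡.refl
  ... | yes E≡∅ = cong
    (λ s → if does (E ≡ Cut.C V mod? P) then pos else if does (E ≡ Cut.D V mod? P) then neg else s)
    (≡.sym (saturated⇒zer X (null⇒saturated Q E≡∅)))

  -- A relation rather than the face `restriction X`, since only signs matter: faces obtained by
  -- recasting or cutting also qualify.
  IsRestriction : {P P′ : Partition n} → Subset n → Face P → Face P′ → Set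
  IsRestriction S X Y = ∀ E → Face.sign Y E ≡ Face.sign X (E ∩ S)

  module _ {P Q P′ : Partition n} (V : Cut P Q) {S : Subset n} (CD : Disjoint (Cut.C V ∪ Cut.D V) S) where
    private
      module V  = CutProperties V
      module V̄ = CutProperties (opposite V)

    -- A set congruent to `C` or `D` mod `P` contains that half, whereas `E ∩ S` misses both. So the
    -- cut changes no sign on subsets of `S`.
    restriction-skip : {X : Face Q} {Y : Face P′} → IsRestriction S X Y → IsRestriction S (X ^ V) Y
    restriction-skip {X} {Y} X↾Y E = ≡.trans (X↾Y E) (≡.sym (≡.trans (sign-^ V X (E ∩ S)) (cong₂
      (λ b b′ → if b then pos else if b′ then neg else Face.sign X (E ∩ S))
      (dec-false ((E ∩ S) ≡ V.C mod? P) λ m → apart (V.C⊆ (proj₂ V.C≢∅)) (V.modC⇒C⊆ m (proj₂ V.C≢∅)))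
      (dec-false ((E ∩ S) ≡ V.D mod? P) λ m → apart (V.D⊆ (proj₂ V.D≢∅)) (V̄.modC⇒C⊆ m (proj₂ V.D≢∅))))))
      where
      apart : ∀ {i} → i ∈ V.C ∪ V.D → i ∉ E ∩ S
      apart i∈ i∈E∩S = ∉-Disjoint CD i∈ (Subset.p∩q⊆q E S i∈E∩S)

  module _ {P Q P′ Q′ : Partition n} (V : Cut P Q) (W : Cut P′ Q′) {S : Subset n}
           (sat : Saturated Q S) (e : Q′ ≈ᴾ (Q ↾ S by sat)) where

    -- Both congruences say that the set is saturated for the partition after the cut, contains `C`
    -- and misses `D`. Intersecting with `S` does not affect points of `C ∪ D`.
    mod-∩ : Cut.C V ∪ Cut.D V ⊆ S → SameSplit V W → ∀ E →
            (E ≡ Cut.C W mod P′) ⇔ (E ∩ S ≡ Cut.C V mod P)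
    mod-∩ CD (C≡ , D≡) E = mk⇔
      (λ m → V.saturated⇒modC (saturated-∩⁺ Q Q′ sat e (W.modC⇒saturated m)) x∈C
               (Subset.x∈p∩q⁺ (W.modC⇒C⊆ m (subst (x ∈_) C≡ x∈C) , CD (V.C⊆ x∈C))) y∈D
               (W.modC⇒∉D m (subst (y ∈_) D≡ y∈D) ∘ Subset.p∩q⊆p E S))
      (λ m → W.saturated⇒modC (saturated-∩⁻ Q Q′ sat e (V.modC⇒saturated m)) (subst (x ∈_) C≡ x∈C)
               (Subset.p∩q⊆p E S (V.modC⇒C⊆ m x∈C)) (subst (y ∈_) D≡ y∈D)
               (λ y∈E → V.modC⇒∉D m y∈D (Subset.x∈p∩q⁺ (y∈E , CD (V.D⊆ y∈D)))))
      where
      module V = CutProperties V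
      module W = CutProperties W
      x = proj₁ V.C≢∅
      y = proj₁ V.D≢∅
      x∈C = proj₂ V.C≢∅
      y∈D = proj₂ V.D≢∅

  opposite-⊆ : {P Q : Partition n} (V : Cut P Q) {S : Subset n} →
               Cut.C V ∪ Cut.D V ⊆ S → Cut.D V ∪ Cut.C V ⊆ S
  opposite-⊆ V {S} = subst (_⊆ S) (Subset.∪-comm (Cut.C V) (Cut.D V))

  opposite-Disjoint : {P Q : Partition n} (V : Cut P Q) {S : Subset n} →
                      Disjoint (Cut.C V ∪ Cut.D V) S → Disjoint (Cut.D V ∪ Cut.C V) S
  opposite-Disjoint V {S} = subst (λ A → Disjoint A S) (Subset.∪-comm (Cut.C V) (Cut.D V))

  -- `mod-∩` matches the positive cases and, applied to the opposite cuts, the negative ones;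
  -- elsewhere the signs are those of `Y` and `X`.
  restriction-take : {P Q P′ Q′ : Partition n} (V : Cut P Q) (W : Cut P′ Q′) {S : Subset n}
    (sat : Saturated Q S) → Q′ ≈ᴾ (Q ↾ S by sat) → Cut.C V ∪ Cut.D V ⊆ S → SameSplit V W →
    {X : Face Q} {Y : Face Q′} → IsRestriction S X Y → IsRestriction S (X ^ V) (Y ^ W)
  restriction-take {P} {Q} {P′} {Q′} V W {S} sat e CD same {X} {Y} X↾Y E = begin
    Face.sign (Y ^ W) E
      ≡⟨ sign-^ W Y E ⟩
    (if does (E ≡ Cut.C W mod? P′) then pos else if does (E ≡ Cut.D W mod? P′) then neg else Face.sign Y E)
      ≡⟨ cong₂ (λ b b′ → if b then pos else if b′ then neg else Face.sign Y E)
           (does-⇔ (mod-∩ V W sat e CD same E) (E ≡ Cut.C W mod? P′) ((E ∩ S) ≡ Cut.C V mod? P))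
           (does-⇔ (mod-∩ (opposite V) (opposite W) sat e (opposite-⊆ V CD) (swap same) E)
             (E ≡ Cut.D W mod? P′) ((E ∩ S) ≡ Cut.D V mod? P)) ⟩
    (if C? then pos else if D? then neg else Face.sign Y E)
      ≡⟨ cong (λ s → if C? then pos else if D? then neg else s) (X↾Y E) ⟩
    (if C? then pos else if D? then neg else Face.sign X (E ∩ S))
      ≡⟨ sign-^ V X (E ∩ S) ⟨
    Face.sign (X ^ V) (E ∩ S) ∎
    where
    open ≡.≡-Reasoning
    C? = does ((E ∩ S) ≡ Cut.C V mod? P)
    D? = does ((E ∩ S) ≡ Cut.D V mod? P)

  -- Following one tensor factor through the cuts.

  -- The state of one tensor factor when the cuts Vs are still to be made.
  record Stage (S : Subset n) {P Q : Partition n} (Vs : Cuts P Q) (Q′ : Partition n) :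
         Set (Level.suc (c Level.⊔ ℓ Level.⊔ r₁ Level.⊔ r₂ Level.⊔ r₃)) where
    field
      {current}   : Partition n
      cuts        : Cuts current Q′
      isComponent : Component S Vs cuts
      saturated   : Saturated P S
      ≈restricted : current ≈ᴾ (P ↾ S by saturated)
      factor      : Functional current

    run : Functional Q′
    run = ∂ˢ cuts · factor

  open Stage

  module _ {S : Subset n} {P Q Q′ : Partition n} {e : P ≈ᴾ Q} where

    pull : (s : Stage S {P} {Q} (done e) Q′) → Face Q′ → Face (current s)
    pull record { cuts = done e′ ; isComponent = done } = recast (↭-sym e′)

    run-done : (s : Stage S {P} {Q} (done e) Q′) (Y : Face Q′) → run s ⟨ Y ⟩ ≈ factor s ⟨ pull s Y ⟩
    run-done record { isComponent = done } Y = refl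

    sign-pull : (s : Stage S {P} {Q} (done e) Q′) (Y : Face Q′) → Face.sign (pull s Y) ≡ Face.sign Y
    sign-pull record { isComponent = done } Y = ≡.refl

  module _ {S : Subset n} {P T Q Q′ : Partition n} {V : Cut P T} {Vs : Cuts T Q} where

    advance : Stage S {P} {Q} (V ⟫ Vs) Q′ → Stage S Vs Q′
    advance record { current = P′ ; cuts = cuts ; isComponent = skip d comp
                   ; saturated = sat ; ≈restricted = e ; factor = f } = record
      { cuts = cuts ; isComponent = comp ; saturated = cut-saturated V sat
      ; ≈restricted = restrict-skip V sat P′ d e ; factor = f }
    advance record { cuts = W ⟫ Ws ; isComponent = take i same comp
                   ; saturated = sat ; ≈restricted = e ; factor = f } = record
      { cuts = Ws ; isComponent = comp ; saturated = cut-saturated V sat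
      ; ≈restricted = restrict-take V sat i W same e ; factor = ∂ᶜ W · f }

    -- A skipped cut leaves the stage's own cuts alone; a taken one only moves its derivative from
    -- the pending cuts into `factor`.
    run-advance : (s : Stage S {P} {Q} (V ⟫ Vs) Q′) → run (advance s) ≡ run s
    run-advance record { isComponent = skip _ _ }   = ≡.refl
    run-advance record { isComponent = take _ _ _ } = ≡.refl

    -- `inside` and `outside` are the hypotheses of `Π-add` at the block being cut and at all other
    -- blocks.
    record Raised (s : Stage S {P} {Q} (V ⟫ Vs) Q′) (X : Face T) (Y : Face (current (advance s))) :
           Set (ℓ Level.⊔ r₁ Level.⊔ r₂ Level.⊔ r₃) where
      field
        above below : Face (current s)
        above-restriction : IsRestriction S (X ^ V) above
        below-restriction : IsRestriction S (X ^ opposite V) below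
        inside  : Cut.C V ∪ Cut.D V ⊆ S →
          factor s ⟨ above ⟩ ≈ factor (advance s) ⟨ Y ⟩ + factor s ⟨ below ⟩
        outside : Disjoint (Cut.C V ∪ Cut.D V) S →
          factor s ⟨ above ⟩ ≈ factor (advance s) ⟨ Y ⟩ × factor s ⟨ above ⟩ ≈ factor s ⟨ below ⟩

    -- A skipped cut does not affect the restriction, so `Y` serves on both sides; a taken one
    -- raises `Y` along `W` and its opposite. The other alternative is absurd because the parent
    -- block is nonempty.
    raise : (s : Stage S {P} {Q} (V ⟫ Vs) Q′) {X : Face T} {Y : Face (current (advance s))} →
            IsRestriction S X Y → Raised s X Y
    raise record { isComponent = skip d _ } {X} {Y} X↾Y = record
      { above = Y
      ; below = Y
      ; above-restriction = restriction-skip V d {X} {Y} X↾Y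
      ; below-restriction = restriction-skip (opposite V) (opposite-Disjoint V d) {X} {Y} X↾Y
      ; inside  = λ CD → ⊥-elim (⊈-Disjoint (parent-nonempty V) d CD)
      ; outside = λ _ → refl , refl
      }
    -- Left implicit, Q is solved by an unreduced term, and the conversion check of
    -- the field inside then unfolds the faces.
    raise record { cuts = _⟫_ {P′ = T′} W _ ; isComponent = take i same _
                 ; saturated = sat ; ≈restricted = e ; factor = f } {X} {Y} X↾Y = record
      { above = _^_ {Q = T′} Y W
      ; below = _^_ {Q = T′} Y (opposite W)
      ; above-restriction = restriction-take V W (cut-saturated V sat) e′ i same {X} {Y} X↾Y
      ; below-restriction = restriction-take (opposite V) (opposite W) (cut-saturated V sat) e′
          (opposite-⊆ V i) (swap same) {X} {Y} X↾Y
      ; inside  = λ _ → ∂ᶜ-raise W f Y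
      ; outside = λ d → ⊥-elim (⊈-Disjoint (parent-nonempty V) d i)
      }
      where
      e′ = restrict-take V sat i W same e

  -- The product rule for sequences of cuts.

  module _ (P₀ : Partition n) where

    -- Quantified over every family `Y` with the right signs, so that the induction can use the
    -- faces supplied by `raise` and `pull` directly.
    IsProduct : {P : Partition n} {Ps : Fin (size P₀) → Partition n} →
                Functional P → (∀ j → Functional (Ps j)) → Set _
    IsProduct {P} {Ps} g f = (X : Face P) (Y : ∀ j → Face (Ps j)) →
      (∀ j → IsRestriction (block P₀ j) X (Y j)) → g ⟨ X ⟩ ≈ Π λ j → f j ⟨ Y j ⟩

    ∂ˢ-product : {P Q : Partition n} (Vs : Cuts P Q) {Qs : Fin (size P₀) → Partition n} →
      P ≼ P₀ → (g : Functional P) (s : ∀ j → Stage (block P₀ j) Vs (Qs j)) →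
      IsProduct g (λ j → factor (s j)) → IsProduct (∂ˢ Vs · g) (λ j → run (s j))
    ∂ˢ-product (done e) P≼ g s g≈ X Y X↾Y = trans
      (g≈ (recast (↭-sym e) X) (λ j → pull (s j) (Y j)) λ j E →
        ≡.trans (cong (λ σ → σ E) (sign-pull (s j) (Y j))) (X↾Y j E))
      (Π-cong λ j → sym (run-done (s j) (Y j)))
    ∂ˢ-product (V ⟫ Vs) P≼ g s g≈ X Y X↾Y = trans
      (∂ˢ-product Vs (cut-≼ P₀ V P≼) (∂ᶜ V · g) (λ j → advance (s j)) ∂g≈ X Y X↾Y)
      (Π-cong λ j → reflexive (cong (_⟨ Y j ⟩) (run-advance (s j))))
      where
      open SetoidReasoning setoid
      -- `P ≼ P₀` places the set being split inside a block of `P₀`, whose index is the one slot of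
      -- the product that changes.
      inBlock : ∃ λ m → Cut.C V ∪ Cut.D V ⊆ block P₀ m
      inBlock with CD ∷ _ ← ↭.All-resp-↭ (Cut.source V) P≼ = Any.index CD , Any.lookup-index CD
      m = proj₁ inBlock
      apart : ∀ {j} → j ≢ m → Disjoint (Cut.C V ∪ Cut.D V) (block P₀ j)
      apart j≢m = Disjoint-⊆ (Cut.C V ∪ Cut.D V) (block P₀ m) (proj₂ inBlock)
                    (block-disjoint P₀ (j≢m ∘ ≡.sym))
      ∂g≈ : IsProduct (∂ᶜ V · g) (λ j → factor (advance (s j)))
      ∂g≈ X Y X↾Y = begin
        g ⟨ X ^ V ⟩ - g ⟨ X ^ opposite V ⟩
          ≈⟨ +-cong (g≈ (X ^ V) (λ j → above (raised j)) λ j → above-restriction (raised j))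
                    (-‿cong (g≈ (X ^ opposite V) (λ j → below (raised j)) λ j → below-restriction (raised j))) ⟩
        Π upper - Π lower
          -- In slot `m` the upper value is the derived one plus the lower one, and in the other
          -- slots all three agree. Expanding in slot `m` leaves `Π lower` to cancel.
          ≈⟨ +-congʳ (Π-add m (inside (raised m) (proj₂ inBlock))
               (λ j j≢m → proj₁ (outside (raised j) (apart j≢m)))
               (λ j j≢m → proj₂ (outside (raised j) (apart j≢m)))) ⟩
        (Π derived + Π lower) - Π lower
          ≈⟨ trans (+-assoc _ _ _) (trans (+-congˡ (-‿inverseʳ _)) (+-identityʳ _)) ⟩
        Π derived ∎
        where
        open Raised
        raised : ∀ j → Raised (s j) X (Y j)
        raised j = raise (s j) {X} {Y j} (X↾Y j)
        upper lower derived : Fin (size P₀) → Field.Carrier K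
        upper   j = factor (s j) ⟨ above (raised j) ⟩
        lower   j = factor (s j) ⟨ below (raised j) ⟩
        derived j = factor (advance (s j)) ⟨ Y j ⟩

-- From cut sequences to layered forests.

theorem4p1 : ∀ {c ℓ r₁ r₂ r₃} (K : Field c ℓ) → CharacteristicZero K → (R : OrderedField r₁ r₂ r₃) →
    (n : ℕ) (P Q : Partition n) (F : LayeredForest P Q) →
    let open Functionals K R n in
    ∂ F ∘ₗ prod P P (≼-refl P) (isolate≈component P)
    ≗ₗ prod P Q (forest⇒≼ F) (λ j → ↭-refl) ∘ₗ ⨂-map (λ j → ∂ (complete-at F j))
-- Both sides are linear in the tensor and yield linear functionals, so it suffices to compare them
-- on pure tensors and single faces.
theorem4p1 K _ R n P Q F = ≗ₗ-on-generators
  (∂ F ∘ₗ prod P P (≼-refl P) (isolate≈component P))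
  (prod P Q (forest⇒≼ F) (λ j → ↭-refl) ∘ₗ ⨂-map (λ j → ∂ (complete-at F j))) λ f →
    ≗ₗ-on-faces
      ((∂ F ∘ₗ prod P P (≼-refl P) (isolate≈component P)) · gen f)
      ((prod P Q (forest⇒≼ F) (λ j → ↭-refl) ∘ₗ ⨂-map (λ j → ∂ (complete-at F j))) · gen f) λ X →
    ∂ˢ-product P (decompose F) (≼-refl P) _ (stages f)
      -- Before any cut the product formula is the definition of `prod`, because a face `Y j` with
      -- the signs of the restriction equals it.
      (λ X Y X↾Y → Π-cong λ j → ⟨⟩-cong (f j) {restrictTo P P (≼-refl P) {ᴵS} (isolate≈component P) X j} {Y j}
        λ E → ≡.sym (X↾Y j E))
      X (restrictTo P Q (forest⇒≼ F) (λ j → ↭-refl) X) (λ j E → ≡.refl)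
  where
  open Functionals K R n
  open ProductRule K R n
  ᴵS : Fin (size P) → Partition n
  ᴵS j = isolate (block P j) (block-nonempty P j)
  open Presented (TensorProduct.Family (L∨* ∘ ᴵS)) (TensorProduct.Multilinear (L∨* ∘ ᴵS)) using (≗ₗ-on-generators)
  stages : TensorProduct.Family (L∨* ∘ ᴵS) → ∀ j →
           Stage (block P j) (decompose F) (component P Q (forest⇒≼ F) j)
  stages f j = record
    { cuts        = decompose (complete-at F j)
    ; isComponent = component-decompose F j
    ; saturated   = ≼⇒Saturated P P (≼-refl P) j
    ; ≈restricted = isolate≈component P j
    ; factor      = f j
    }
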